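{- For every integer $k\geq 3$, $$\operatorname{gr}_k(P_5:S_5^1)= \begin{cases} 21, & k=3;\\ 6, & k=4,5;\\ 5, & k=6;\\ \left\lceil\frac{1+\sqrt{1+8k}}{2}\right\rceil, & k\geq 7. \end{cases}$$
   Context: All graphs are finite, simple and undirected. $K_n$ is the complete graph on $n$ vertices and $P_5$ is the path with $5$ vertices and $4$ edges. $S_t^r$ is the graph of order $t$ obtained from the star $K_{1,t-1}$ by adding $r$ pairwise independent edges between the leaves; thus $S_5^1$ is the star $K_{1,4}$ with one edge added between two leaves. A $k$-edge-coloring assigns to each edge one of $k$ colors; all $k$-edge-colorings are assumed exact, i.e. each of the $k$ colors is used at least once. An edge-colored graph is rainbow if all its edges have different colors and monochromatic if all its edges have a single color. A copy of a graph means a (not necessarily induced) subgraph isomorphic to it. For non-empty graphs $G,H$ (graphs with at least one edge) and a positive integer $k$, the Gallai-Ramsey number $\operatorname{gr}_k(G:H)$ is the minimum integer $N$ with $\binom{N}{2}\geq k$ (so that $K_N$ admits a $k$-edge-coloring) such that for all $n\geq N$, every $k$-edge-coloring of $K_n$ contains either a rainbow copy of $G$ or a monochromatic copy of $H$. -}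

module Defs where

open import Data.Nat using (ℕ; suc; _+_; _*_; _≤_; _≥_; _<_)
open import Data.Nat.Properties using (1+n≢n; suc-injective)
open import Data.Nat.Combinatorics using (_C_)
open import Data.Integer as ℤ using (ℤ; +_; 0ℤ; 1ℤ)
open import Data.Fin using (Fin; toℕ)
open import Data.Product using (Σ-syntax; ∃-syntax; _×_)
open import Data.Sum using (_⊎_)
open import Function.Definitions using (Injective)
open import Level using (0ℓ)
open import Relation.Binary.Core using (Rel)
open import Relation.Binary.Definitions using (Symmetric)
open import Relation.Binary.Construct.Closure.Symmetric as Sym
  using (SymClosure; fwd; bwd)
open import Relation.Binary.PropositionalEquality
  using (_≡_; _≢_; refl; sym; trans)
open import Relation.Nullary using (¬_)

record Graph (n : ℕ) : Set₁ where
  field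
    Adj       : Rel (Fin n) 0ℓ
    symmetric : Symmetric Adj
    loopless  : ∀ v → ¬ Adj v v

open Graph public

K : ∀ n → Graph n
K n = record
  { Adj       = _≢_
  ; symmetric = λ u≢v v≡u → u≢v (sym v≡u)
  ; loopless  = λ v v≢v → v≢v refl
  }

fromEdges : ∀ {n} (E : Rel (Fin n) 0ℓ) → (∀ v → ¬ E v v) → Graph n
fromEdges E irr = record
  { Adj       = SymClosure E
  ; symmetric = Sym.symmetric E
  ; loopless  = λ { v (fwd e) → irr v e ; v (bwd e) → irr v e }
  }

-- P n has n vertices (and n ∸ 1 edges).
P : ∀ n → Graph n
P n = fromEdges (λ u v → toℕ v ≡ suc (toℕ u)) (λ v e → 1+n≢n (sym e))

-- Vertex 0 is the centre and 1, …, t ∸ 1 are the leaves; the r added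
-- independent edges are {1,2}, {3,4}, …, {2r ∸ 1, 2r}.  This is the graph
-- S_t^r when 2r ≤ t ∸ 1 (for larger r not all r edges fit).
data SEdge (t r : ℕ) (u v : Fin t) : Set where
  spoke : toℕ u ≡ 0 → toℕ v ≢ 0 → SEdge t r u v
  extra : ∀ s → s < r → toℕ u ≡ 1 + 2 * s → toℕ v ≡ 2 + 2 * s → SEdge t r u v

S : ∀ t → ℕ → Graph t
S t r = fromEdges (SEdge t r) irr
  where
  irr : ∀ v → ¬ SEdge t r v v
  irr v (spoke v≡0 v≢0)  = v≢0 v≡0
  irr v (extra s _ p q) = 1+n≢n (suc-injective (trans (sym q) p))

-- Only the values of colour on adjacent pairs matter; in particular the
-- exactness condition ignores all other pairs.
record ExactColouring (k : ℕ) {n : ℕ} (G : Graph n) : Set where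
  field
    colour     : Fin n → Fin n → Fin k
    colour-sym : ∀ u v → colour u v ≡ colour v u
    exact      : ∀ c → ∃[ u ] ∃[ v ] Adj G u v × colour u v ≡ c

open ExactColouring public

record Copy {m n : ℕ} (H : Graph m) (G : Graph n) : Set where
  field
    to        : Fin m → Fin n
    injective : Injective _≡_ _≡_ to
    edge      : ∀ {u v} → Adj H u v → Adj G (to u) (to v)

open Copy public

module _ {k m n : ℕ} {H : Graph m} {G : Graph n} where

  Rainbow : ExactColouring k G → Copy H G → Set
  Rainbow c f = ∀ {u v x y} → Adj H u v → Adj H x y →
    colour c (to f u) (to f v) ≡ colour c (to f x) (to f y) →
    (u ≡ x × v ≡ y) ⊎ (u ≡ y × v ≡ x)

  Monochromatic : ExactColouring k G → Copy H G → Set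
  Monochromatic c f = ∃[ a ] ∀ {u v} → Adj H u v →
    colour c (to f u) (to f v) ≡ a

IsLeast : {A : Set} → Rel A 0ℓ → (A → Set) → A → Set
IsLeast _≼_ Q x = Q x × (∀ y → Q y → x ≼ y)

GRBound : ℕ → ∀ {g h} → Graph g → Graph h → ℕ → Set
GRBound k G H N = k ≤ N C 2 ×
  (∀ n → n ≥ N → (c : ExactColouring k (K n)) →
    (Σ[ f ∈ Copy G (K n) ] Rainbow c f) ⊎
    (Σ[ f ∈ Copy H (K n) ] Monochromatic c f))

-- The number gr_k(G : H) as a relation: gr k [ G ∶ H ]≐ N says that it
-- exists and equals N.
gr_[_∶_]≐_ : ℕ → ∀ {g h} → Graph g → Graph h → ℕ → Set
gr k [ G ∶ H ]≐ N = IsLeast _≤_ (GRBound k G H) N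

-- A real number x is represented by its integer upper bounds: X z stands
-- for x ≤ z.  This determines ⌈x⌉, the least such z.  It suffices for the
-- operations below, since 1 + x ≤ z iff x ≤ z - 1, and x / 2 ≤ z iff x ≤ 2z.
UpperBounds : Set₁
UpperBounds = ℤ → Set

infix  9 √_
infixr 6 1+_
infixl 7 _/2

√_ : ℕ → UpperBounds
(√ m) z = 0ℤ ℤ.≤ z × + m ℤ.≤ z ℤ.* z

1+_ : UpperBounds → UpperBounds
(1+ X) z = X (z ℤ.- 1ℤ)

_/2 : UpperBounds → UpperBounds
(X /2) z = X (+ 2 ℤ.* z)

⌈_⌉≐_ : UpperBounds → ℕ → Set
⌈ X ⌉≐ N = IsLeast ℤ._≤_ X (+ N)

{-# OPTIONS --safe #-}
module Submission where

-- Three colours.  Suppose no colour contains S₅¹, that is, a vertex of degree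
-- at least 4 in a colour lies on no triangle of that colour.  Among 9 vertices
-- coloured with only two colours, all degrees would be exactly 4, and four
-- neighbours in one colour would form a clique in the other.  So with 21
-- vertices every colour degree is at most 8, hence at least 4, and there is no
-- monochromatic triangle at all; but some colour degree is at least 6, and
-- R(3, 3) = 6.
--
-- At least four colours.  There is a rainbow P₄: otherwise take v, x, y with vx
-- and vy of different colours; an edge of any third colour γ forces xy to have
-- colour γ, and there are two such γ.  A rainbow P₄ and an edge of a fourth
-- colour span at most 6 vertices, and an exhaustive search over the colourings
-- of K₆ extending them ends the case n ≥ 6.  In K₅ the search leaves only
-- colourings with at most 5 colours.

open import Data.Bool using (Bool; true; false; T; _∧_; _∨_; not; if_then_else_)
open import Data.Bool.ListAction using (any; all)
open import Data.Bool.Properties using (T-∧; T-∨; T-≡)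
open import Data.Empty using (⊥; ⊥-elim)
open import Data.Fin as Fin using (Fin; zero; suc; #_; toℕ; inject₁)
import Data.Fin.Properties as Fin
open import Data.Integer as ℤ using (ℤ; +_; -[1+_]; 1ℤ)
import Data.Integer.Properties as ℤ
open import Data.List using (List; []; _∷_; map; length; filter; filterᵇ; allFin; concatMap; partitionᵇ)
import Data.List.Membership.DecPropositional as DecMembership
open import Data.List.Membership.Propositional using (_∈_; _∉_; find)
open import Data.List.Membership.Propositional.Properties using (∈-filter⁺; ∈-filter⁻; ∈-allFin)
open import Data.List.Properties using (map-∘; map-cong; filter-all; length-tabulate)
import Data.List.Relation.Binary.Permutation.Propositional as Perm
open import Data.List.Relation.Binary.Permutation.Propositional using (_↭_; ↭-refl; ↭-sym; ↭-trans; ↭-reflexive)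
open import Data.List.Relation.Binary.Permutation.Propositional.Properties using (∈-resp-↭)
import Data.List.Relation.Binary.Permutation.Setoid.Properties as PermSetoid
open import Data.List.Relation.Binary.Pointwise using (Pointwise; []; _∷_; Pointwise-length)
open import Data.List.Relation.Unary.All as All using (All; []; _∷_)
import Data.List.Relation.Unary.All.Properties as All
open import Data.List.Relation.Unary.AllPairs using ([]; _∷_; allPairs?)
open import Data.List.Relation.Unary.Any as Any using (Any; here; there)
import Data.List.Relation.Unary.Any.Properties as Any
open import Data.List.Relation.Unary.Unique.Propositional using (Unique)
import Data.List.Relation.Unary.Unique.Propositional.Properties as Unique
open import Data.Maybe as Maybe using (Maybe; just; nothing; maybe)
open import Data.Nat using (ℕ; zero; suc; _+_; _*_; _/_; _⊓_; _⊔_; _<_; _≤_; _≥_; z≤n; s≤s; _≡ᵇ_; _≤ᵇ_; _≤?_; ∣_-_∣; NonZero)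
open import Data.Nat.Combinatorics using (_C_; nC1≡n; nCk+nC[k+1]≡[n+1]C[k+1])
open import Data.Nat.DivMod using (_mod_)
import Data.Nat.Properties as ℕ
open import Data.Nat.Tactic.RingSolver using (solve-∀)
open import Data.Product using (∃-syntax; Σ-syntax; _×_; _,_; uncurry; proj₁; proj₂)
open import Data.Product.Properties using (≡-dec)
open import Data.Sum as Sum using (_⊎_; inj₁; inj₂; [_,_]′)
open import Data.Vec using (Vec; []; _∷_; lookup; fromList) renaming (map to mapᵛ)
import Data.Vec.Membership.Propositional as Vec
import Data.Vec.Relation.Unary.All as Vec
open import Data.Vec.Relation.Unary.All using ([]; _∷_)
import Data.Vec.Relation.Unary.All.Properties as VecAll
import Data.Vec.Relation.Unary.AllPairs as Vec
open import Data.Vec.Relation.Unary.AllPairs using ([]; _∷_)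
import Data.Vec.Relation.Unary.Any as Vec
open import Data.Vec.Relation.Unary.Any using (here; there)
import Data.Vec.Relation.Unary.Any.Properties as VecAny
import Data.Vec.Relation.Unary.Unique.Propositional as Vec
import Data.Vec.Relation.Unary.Unique.Propositional.Properties as VecUnique
open import Function using (_∘_; Equivalence)
open import Function.Definitions using (Injective)
open import Level using (0ℓ)
open import Relation.Binary.Construct.Closure.Symmetric using (fwd; bwd)
open import Relation.Binary.PropositionalEquality
open import Relation.Nullary using (¬_; Dec; yes; no; ¬?; does; contradiction)
open import Relation.Nullary.Decidable using (map′; _×-dec_; _⊎-dec_; _→-dec_; from-yes; decidable-stable)
open import Relation.Unary using (Pred; Decidable)
open import Defs

private variable
  A : Set
  k m n r : ℕ

-- Vectors of distinct vertices

_≢?_ : (x y : Fin n) → Dec (x ≢ y)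
x ≢? y = ¬? (x Fin.≟ y)

member : (x : Fin n) (xs : Vec (Fin n) m) → x Vec.∈ xs ⊎ Vec.All (x ≢_) xs
member x []       = inj₂ []
member x (y ∷ xs) with x Fin.≟ y | member x xs
... | yes x≡y | _         = inj₁ (here x≡y)
... | no  x≢y | inj₁ x∈xs = inj₁ (there x∈xs)
... | no  x≢y | inj₂ x∉xs = inj₂ (x≢y ∷ x∉xs)

-- Pigeonhole: if every `x` occurred in `xs`, its position would inject `Fin n` into `Fin m`.
fresh : (xs : Vec (Fin n) m) → m < n → ∃[ x ] Vec.All (x ≢_) xs
fresh {n} xs m<n with Fin.any? (λ x → Vec.all? (λ y → x ≢? y) xs)
... | yes x∉xs = x∉xs
... | no  all∈ = contradiction (Fin.injective⇒≤ {f = Vec.index ∘ all-in} λ {x} {y} eq →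
    trans (VecAny.lookup-index (all-in x)) (trans (cong (lookup xs) eq) (sym (VecAny.lookup-index (all-in y)))))
  (ℕ.<⇒≱ m<n)
  where
  all-in : ∀ x → x Vec.∈ xs
  all-in x with member x xs
  ... | inj₁ x∈xs = x∈xs
  ... | inj₂ x∉xs = contradiction (x , x∉xs) all∈

spanning : {xs : Vec (Fin n) m} → Vec.Unique xs → n ≤ m → ∀ x → x Vec.∈ xs
spanning {xs = xs} xs! n≤m x with member x xs
... | inj₁ x∈xs = x∈xs
... | inj₂ x∉xs = contradiction
  (Fin.injective⇒≤ (VecUnique.lookup-injective {xs = x ∷ xs} (x∉xs ∷ xs!) _ _)) (ℕ.<⇒≱ (s≤s n≤m))

∃-vec? : ∀ {r} {Q : Pred (Vec (Fin n) r) 0ℓ} → Decidable Q → Dec (∃[ xs ] Q xs)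
∃-vec? {r = zero}  Q? = map′ ([] ,_) (λ { ([] , q) → q }) (Q? [])
∃-vec? {r = suc r} Q? = map′ (λ { (x , xs , q) → x ∷ xs , q }) (λ { (x ∷ xs , q) → x , xs , q })
  (Fin.any? λ x → ∃-vec? (Q? ∘ (x ∷_)))

-- Rainbow paths and monochromatic stars

pathEdges : Vec A r → List (A × A)
pathEdges []           = []
pathEdges (x ∷ [])     = []
pathEdges (x ∷ y ∷ xs) = (x , y) ∷ pathEdges (y ∷ xs)

starEdges : Vec A 5 → List (A × A)
starEdges (v ∷ x ∷ y ∷ z ∷ w ∷ []) = (v , x) ∷ (v , y) ∷ (v , z) ∷ (v , w) ∷ (x , y) ∷ []

RainbowPath : ∀ r → (A → A → Fin k) → Set
RainbowPath r c = ∃[ p ] Vec.Unique {n = r} p × Unique (map (uncurry c) (pathEdges p))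

MonoStar : (A → A → Fin k) → Set
MonoStar c = ∃[ p ] Vec.Unique p × ∃[ a ] All (λ e → uncurry c e ≡ a) (starEdges p)

-- Decidability is what allows the existence of paths and stars to be proved by contradiction.
rainbowPath? : ∀ r (c : Fin n → Fin n → Fin k) → Dec (RainbowPath r c)
rainbowPath? r c = ∃-vec? λ p → Vec.allPairs? _≢?_ p ×-dec allPairs? _≢?_ _

monoStar? : (c : Fin n → Fin n → Fin k) → Dec (MonoStar c)
monoStar? c = ∃-vec? λ p → Vec.allPairs? _≢?_ p ×-dec
  Fin.any? λ a → All.all? (λ e → uncurry c e Fin.≟ a) (starEdges p)

module _ {c : Fin n → Fin n → Fin k} (vs : Vec (Fin n) m) (vs! : Vec.Unique vs) where

  private
    c∘vs : Fin m → Fin m → Fin k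
    c∘vs u v = c (lookup vs u) (lookup vs v)

  -- Matching `p` in full makes `pathEdges` compute, so the colours along the image path agree with
  -- those along `p` by definition.
  rainbowPath-lookup : RainbowPath 5 c∘vs → RainbowPath 5 c
  rainbowPath-lookup (p@(_ ∷ _ ∷ _ ∷ _ ∷ _ ∷ []) , p! , cs!) =
    mapᵛ (lookup vs) p , VecUnique.map⁺ (VecUnique.lookup-injective vs! _ _) p! , cs!

  monoStar-lookup : MonoStar c∘vs → MonoStar c
  monoStar-lookup (p@(_ ∷ _ ∷ _ ∷ _ ∷ _ ∷ []) , p! , a , e₁ ∷ e₂ ∷ e₃ ∷ e₄ ∷ e₅ ∷ []) =
    mapᵛ (lookup vs) p , VecUnique.map⁺ (VecUnique.lookup-injective vs! _ _) p! ,
    a , e₁ ∷ e₂ ∷ e₃ ∷ e₄ ∷ e₅ ∷ []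

successor : ∀ {u v : Fin (suc n)} → toℕ v ≡ suc (toℕ u) → ∃[ i ] u ≡ inject₁ i × v ≡ suc i
successor {v = suc i} eq =
  i , Fin.toℕ-injective (trans (sym (ℕ.suc-injective eq)) (sym (Fin.toℕ-inject₁ i))) , refl

module _ (col : ExactColouring k (K n)) where

  private
    toK : (p : Vec (Fin n) 5) → Vec.Unique p → (H : Graph 5) → Copy H (K n)
    toK p p! H .to        = lookup p
    toK p p! H .injective = VecUnique.lookup-injective p! _ _
    toK p p! H .edge {u} {v} uv eq with refl ← VecUnique.lookup-injective p! u v eq = loopless H u uv

  rainbowPath⇒copy : RainbowPath 5 (colour col) → Σ[ f ∈ Copy (P 5) (K n) ] Rainbow col f
  rainbowPath⇒copy (p@(p₀ ∷ p₁ ∷ p₂ ∷ p₃ ∷ p₄ ∷ []) , p! ,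
                    (c₀₁ ∷ c₀₂ ∷ c₀₃ ∷ []) ∷ (c₁₂ ∷ c₁₃ ∷ []) ∷ (c₂₃ ∷ []) ∷ [] ∷ []) =
    toK p p! (P 5) , λ { {u} {v} {x} {y} → rainbow {u} {v} {x} {y} }
    where
    colours : Vec (Fin k) 4
    colours = colour col p₀ p₁ ∷ colour col p₁ p₂ ∷ colour col p₂ p₃ ∷ colour col p₃ p₄ ∷ []

    colours! : Vec.Unique colours
    colours! = (c₀₁ ∷ c₀₂ ∷ c₀₃ ∷ []) ∷
               (c₁₂ ∷ c₁₃ ∷ []) ∷ (c₂₃ ∷ []) ∷ [] ∷ []

    step-colour : ∀ i → colour col (lookup p (inject₁ i)) (lookup p (suc i)) ≡ lookup colours i
    step-colour zero = refl
    step-colour (suc zero) = refl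
    step-colour (suc (suc zero)) = refl
    step-colour (suc (suc (suc zero))) = refl

    forward : ∀ {u v x y} → toℕ v ≡ suc (toℕ u) → toℕ y ≡ suc (toℕ x) →
      colour col (lookup p u) (lookup p v) ≡ colour col (lookup p x) (lookup p y) → u ≡ x × v ≡ y
    forward uv xy eq with i , refl , refl ← successor uv | j , refl , refl ← successor xy
      with refl ← VecUnique.lookup-injective colours! i j (trans (sym (step-colour i)) (trans eq (step-colour j))) = refl , refl

    flip-colour : ∀ {u v a} → colour col u v ≡ a → colour col v u ≡ a
    flip-colour = trans (colour-sym col _ _)

    rainbow : Rainbow col (toK p p! (P 5))
    rainbow (fwd e) (fwd f) eq = inj₁ (forward e f eq)
    rainbow (fwd e) (bwd f) eq with a , b ← forward e f (trans eq (colour-sym col _ _)) = inj₂ (a , b)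
    rainbow (bwd e) (fwd f) eq with a , b ← forward e f (flip-colour eq) = inj₂ (b , a)
    rainbow (bwd e) (bwd f) eq
      with a , b ← forward e f (flip-colour (trans eq (colour-sym col _ _))) = inj₁ (b , a)

  monoStar⇒copy : MonoStar (colour col) → Σ[ f ∈ Copy (S 5 1) (K n) ] Monochromatic col f
  monoStar⇒copy (p@(v ∷ x ∷ y ∷ z ∷ w ∷ []) , p! , a , vx ∷ vy ∷ vz ∷ vw ∷ xy ∷ []) =
    toK p p! (S 5 1) , a , λ { {u} {v} (fwd e) → mono u v e
                             ; {u} {v} (bwd e) → trans (colour-sym col _ _) (mono v u e) }
    where
    mono : ∀ u v → SEdge 5 1 u v → colour col (lookup p u) (lookup p v) ≡ a
    mono zero zero (spoke _ v≢0) = contradiction refl v≢0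
    mono zero (suc zero) (spoke _ _) = vx
    mono zero (suc (suc zero)) (spoke _ _) = vy
    mono zero (suc (suc (suc zero))) (spoke _ _) = vz
    mono zero (suc (suc (suc (suc zero)))) (spoke _ _) = vw
    mono u v (extra zero _ p q)
      with refl ← Fin.toℕ-injective {i = u} {suc zero} p
         | refl ← Fin.toℕ-injective {i = v} {suc (suc zero)} q = xy
    mono _ _ (extra (suc _) (s≤s ()) _ _)

-- Exhaustive search

-- Edges are named by numbers.  A State is the list of colour classes of the
-- edges coloured so far, so colours are taken up to renaming.  A Step is the
-- next edge to colour, with the patterns that must not be rainbow and those
-- that must not be monochromatic whose last edge it is.
Pattern State Step : Set
Pattern = List ℕ
State   = List (List ℕ)
Step    = ℕ × List Pattern × List Pattern

_∈ᵇ_ : ℕ → List ℕ → Bool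
e ∈ᵇ es = any (e ≡ᵇ_) es

remove : ℕ → State → Maybe State
remove e []      = nothing
remove e (x ∷ s) = if e ∈ᵇ x then just s else Maybe.map (x ∷_) (remove e s)

-- Each edge uses up its colour class, so a second edge of that class, like an edge not yet
-- coloured, makes the test fail.
rainbow : Pattern → State → Bool
rainbow []       s = true
rainbow (e ∷ es) s = maybe (rainbow es) false (remove e s)

mono : Pattern → State → Bool
mono es = any λ x → all (_∈ᵇ x) es

closed : List Pattern → List Pattern → State → Bool
closed ps qs s = any (λ p → rainbow p s) ps ∨ any (λ q → mono q s) qs

-- With `b` equal to 0 every non-empty state fails here, so a search from such a state succeeds only
-- by closing every branch.
complete : ℕ → List ℕ → State → Bool
complete b es s = (length s ≤ᵇ b) ∧ all (λ e → any (e ∈ᵇ_) s) es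

insertions : ℕ → State → List State
insertions e []      = []
insertions e (x ∷ s) = ((e ∷ x) ∷ s) ∷ map (x ∷_) (insertions e s)

extensions : ℕ → State → List State
extensions e s = ((e ∷ []) ∷ s) ∷ insertions e s

search : ℕ → List ℕ → List Step → State → Bool
search b es []                     s = complete b es s
search b es ((e , ps , qs) ∷ plan) s =
  all (λ s′ → closed ps qs s′ ∨ search b es plan s′) (extensions e s)

makePlan : List ℕ → List ℕ → List Pattern → List Pattern → List Step
makePlan done []       ps qs = []
makePlan done (e ∷ es) ps qs =
  let ps₁ , ps₂ = partitionᵇ (all (_∈ᵇ (e ∷ done))) ps
      qs₁ , qs₂ = partitionᵇ (all (_∈ᵇ (e ∷ done))) qs
  in (e , ps₁ , qs₁) ∷ makePlan (e ∷ done) es ps₂ qs₂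

-- The initial state puts each edge of `ds` in a class of its own: these edges are taken to have
-- distinct colours.
refutes : ℕ → List ℕ → List Pattern → List Pattern → List ℕ → Bool
refutes b es ps qs ds =
  search b es (makePlan ds (filterᵇ (λ e → not (e ∈ᵇ ds)) es) ps qs) (map (_∷ []) ds)

module _ (f : ℕ → Fin k) where

  -- The list records the actual colour of each class under `f`. That different classes have
  -- different colours is kept apart, as `Unique cs`.
  Realises : State → List (Fin k) → Set
  Realises = Pointwise λ x a → All (λ e → f e ≡ a) x

  FewColours : ℕ → List ℕ → Set
  FewColours b es = ∃[ cs ] length cs ≤ b × All (λ e → f e ∈ cs) es

  NotRainbow NotMono : Pattern → Set
  NotRainbow es = ¬ Unique (map f es)
  NotMono    es = ¬ (∃[ a ] All (λ e → f e ≡ a) es)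

  ∈ᵇ-sound : ∀ {e x a} → All (λ e → f e ≡ a) x → T (e ∈ᵇ x) → f e ≡ a
  ∈ᵇ-sound {e} fx t with d , d∈x , e≡d ← find (Any.any⁻ (e ≡ᵇ_) _ t) =
    trans (cong f (ℕ.≡ᵇ⇒≡ e d e≡d)) (All.lookup fx d∈x)

  remove-sound : ∀ {e s s′ cs} → Realises s cs → remove e s ≡ just s′ →
    ∃[ cs′ ] Realises s′ cs′ × cs ↭ f e ∷ cs′
  remove-sound {e} {x ∷ s} {cs = a ∷ cs} (fx ∷ fs) eq with e ∈ᵇ x in e∈x
  remove-sound {e} {x ∷ s} {cs = a ∷ cs} (fx ∷ fs) refl | true =
    cs , fs , ↭-reflexive (cong (_∷ cs) (sym (∈ᵇ-sound fx (subst T (sym e∈x) _))))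
  ... | false with remove e s in eq′
  remove-sound {e} {x ∷ s} {cs = a ∷ cs} (fx ∷ fs) refl | false | just _
    with cs′ , fs′ , cs↭ ← remove-sound fs eq′ =
    a ∷ cs′ , fx ∷ fs′ , ↭-trans (Perm.prep a cs↭) (Perm.swap a (f e) ↭-refl)

  -- The second conclusion feeds the induction: the later edges take their colours from `cs′`, which
  -- lacks `f e` because `cs` has no repetition.
  rainbow-sound : ∀ es {s cs} → Realises s cs → Unique cs → T (rainbow es s) →
    Unique (map f es) × All (λ e → f e ∈ cs) es
  rainbow-sound []       fs cs! t = [] , []
  rainbow-sound (e ∷ es) {s} fs cs! t with remove e s in eq
  ... | just s′
    with cs′ , fs′ , cs↭ ← remove-sound fs eq
    with e∉cs′ ∷ cs′! ← PermSetoid.Unique-resp-↭ (setoid _) (Perm.↭⇒↭ₛ cs↭) cs!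
    with es! , es∈ ← rainbow-sound es fs′ cs′! t =
    All.map⁺ (All.map (λ d∈cs′ → All.lookup e∉cs′ d∈cs′) es∈) ∷ es! ,
    ∈-resp-↭ (↭-sym cs↭) (here refl) ∷ All.map (∈-resp-↭ (↭-sym cs↭) ∘ there) es∈

  mono-sound : ∀ es {s cs} → Realises s cs → T (mono es s) → ∃[ a ] All (λ e → f e ≡ a) es
  mono-sound es {x ∷ s} (fx ∷ fs) t with Equivalence.to (T-∨ {all (_∈ᵇ x) es}) t
  ... | inj₁ es∈x = _ , All.map (∈ᵇ-sound fx) (All.all⁺ (_∈ᵇ x) es es∈x)
  ... | inj₂ rest = mono-sound es fs rest

  insertions-sound : ∀ {e s cs} → Realises s cs → f e ∈ cs →
    Any (λ s′ → Realises s′ cs) (insertions e s)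
  insertions-sound (fx ∷ fs) (here e≡a)   = here ((e≡a ∷ fx) ∷ fs)
  insertions-sound (fx ∷ fs) (there e∈cs) =
    there (Any.map⁺ (Any.map (fx ∷_) (insertions-sound fs e∈cs)))

  extensions-sound : ∀ e {s cs} → Realises s cs → Unique cs →
    ∃[ cs′ ] Unique cs′ × Any (λ s′ → Realises s′ cs′) (extensions e s)
  extensions-sound e {cs = cs} fs cs! with DecMembership._∈?_ Fin._≟_ (f e) cs
  ... | yes e∈cs = cs , cs! , there (insertions-sound fs e∈cs)
  ... | no  e∉cs = f e ∷ cs , All.¬Any⇒All¬ cs e∉cs ∷ cs! , here ((refl ∷ []) ∷ fs)

  complete-sound : ∀ b es {s cs} → Realises s cs → T (complete b es s) → FewColours b es
  complete-sound b es {s} {cs} fs t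
    with small , covered ← Equivalence.to (T-∧ {length s ≤ᵇ b}) t =
    cs , subst (_≤ b) (Pointwise-length fs) (ℕ.≤ᵇ⇒≤ _ _ small) ,
    All.map (∈-sound fs) (All.all⁺ _ es covered)
    where
    ∈-sound : ∀ {s cs e} → Realises s cs → T (any (e ∈ᵇ_) s) → f e ∈ cs
    ∈-sound {x ∷ s} {e = e} (fx ∷ fs) t with Equivalence.to (T-∨ {e ∈ᵇ x}) t
    ... | inj₁ e∈x = here (∈ᵇ-sound fx e∈x)
    ... | inj₂ e∈s = there (∈-sound fs e∈s)

  StepAvoids : Step → Set
  StepAvoids (_ , ps , qs) = All NotRainbow ps × All NotMono qs

  -- The actual colouring `f` selects one extension at each step. It cannot be closed, since the
  -- offending pattern would be rainbow or monochromatic under `f`; so this branch ends in a state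
  -- accepted by `complete`.
  search-sound : ∀ b es {plan s cs} → All StepAvoids plan → Realises s cs → Unique cs →
    T (search b es plan s) → FewColours b es
  search-sound b es [] fs cs! t = complete-sound b es fs t
  search-sound b es {(e , ps , qs) ∷ plan} {s} ((avoidsP , avoidsQ) ∷ avoids) fs cs! t
    with cs′ , cs′! , ext ← extensions-sound e fs cs!
    with s′ , s′∈ , fs′ ← find ext
    with Equivalence.to (T-∨ {closed ps qs s′}) (All.lookup (All.all⁺ _ (extensions e s) t) s′∈)
  ... | inj₂ rest = search-sound b es avoids fs′ cs′! rest
  ... | inj₁ hit with Equivalence.to (T-∨ {any (λ p → rainbow p s′) ps}) hit
  ... | inj₁ hitP with p , p∈ , tp ← find (Any.any⁻ _ ps hitP) =
    contradiction (proj₁ (rainbow-sound p fs′ cs′! tp)) (All.lookup avoidsP p∈)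
  ... | inj₂ hitQ with q , q∈ , tq ← find (Any.any⁻ _ qs hitQ) =
    contradiction (mono-sound q fs′ tq) (All.lookup avoidsQ q∈)

  makePlan-avoids : ∀ done es {ps qs} → All NotRainbow ps → All NotMono qs →
    All StepAvoids (makePlan done es ps qs)
  makePlan-avoids done []       avoidsP avoidsQ = []
  makePlan-avoids done (e ∷ es) {ps} {qs} avoidsP avoidsQ =
    (proj₁ splitP , proj₁ splitQ) ∷ makePlan-avoids (e ∷ done) es (proj₂ splitP) (proj₂ splitQ)
    where
    split : ∀ {Q : Pattern → Set} {xs} → All Q xs →
      All Q (proj₁ (partitionᵇ (all (_∈ᵇ (e ∷ done))) xs)) ×
      All Q (proj₂ (partitionᵇ (all (_∈ᵇ (e ∷ done))) xs))
    split {xs = []}     [] = [] , []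
    split {xs = x ∷ xs} (qx ∷ qxs) with all (_∈ᵇ (e ∷ done)) x | split qxs
    ... | true  | l , r = qx ∷ l , r
    ... | false | l , r = l , qx ∷ r
    splitP = split avoidsP
    splitQ = split avoidsQ

  refutes-sound : ∀ b es {ps qs} ds → All NotRainbow ps → All NotMono qs → Unique (map f ds) →
    T (refutes b es ps qs ds) → FewColours b es
  refutes-sound b es ds avoidsP avoidsQ ds! =
    search-sound b es (makePlan-avoids ds (filterᵇ (λ e → not (e ∈ᵇ ds)) es) avoidsP avoidsQ) (singletons ds) ds!
    where
    singletons : ∀ ds → Realises (map (_∷ []) ds) (map f ds)
    singletons []       = []
    singletons (d ∷ ds) = (refl ∷ []) ∷ singletons ds

-- Base `m` with the smaller endpoint as leading digit, so both orientations of an edge share a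
-- number.
code : Fin m → Fin m → ℕ
code {m} u v = (toℕ u ⊓ toℕ v) * m + (toℕ u ⊔ toℕ v)

decode : ∀ m .{{_ : NonZero m}} → ℕ → Fin m × Fin m
decode m e = (e / m) mod m , e mod m

edgeCodes : ℕ → List ℕ
edgeCodes m = concatMap (λ u → map (code u) (filter (u Fin.<?_) (allFin m))) (allFin m)

arrangements : ∀ m r → List (Vec (Fin m) r)
arrangements m zero    = [] ∷ []
arrangements m (suc r) =
  concatMap (λ p → map (_∷ p) (filter (λ v → Vec.all? (λ u → ¬? (v Fin.≟ u)) p) (allFin m))) (arrangements m r)

arrangements-unique : ∀ m r → All Vec.Unique (arrangements m r)
arrangements-unique m zero    = [] ∷ []
arrangements-unique m (suc r) = All.concat⁺ (All.map⁺ (All.map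
  (λ {p} p! → All.map⁺ (All.map (_∷ p!) (All.all-filter _ (allFin m))))
  (arrangements-unique m r)))

pathPatterns starPatterns : ℕ → List Pattern
pathPatterns m = map (map (uncurry code) ∘ pathEdges) (arrangements m 5)
starPatterns m = map (map (uncurry code) ∘ starEdges) (arrangements m 5)

-- One search for each possible position of an edge with a further colour. Edges of `ds` are
-- skipped, their colours being taken.
refutesAll : (m b : ℕ) → List ℕ → Bool
refutesAll m b ds =
  let ps = pathPatterns m
      qs = starPatterns m
      es = edgeCodes m
  in all (λ e → e ∈ᵇ ds ∨ refutes b es ps qs (e ∷ ds)) es

-- A record, because comparing two unfolded searches is not feasible; for the
-- same reason the search results below are abstract.
record Refuted (m b : ℕ) (ds : List ℕ) : Set where
  constructor refuted
  field evidence : refutesAll m b ds ≡ true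

-- A finite check for each `m`, done by evaluation for 5 and 6.
Faithful : ∀ m → .{{NonZero m}} → Set
Faithful m = (u v : Fin m) →
  (decode m (code u v) ≡ (u , v) ⊎ decode m (code u v) ≡ (v , u)) × (u ≢ v → code u v ∈ edgeCodes m)

faithful? : ∀ m .{{_ : NonZero m}} → Dec (Faithful m)
faithful? m = Fin.all? λ u → Fin.all? λ v →
  (decode m (code u v) ≟ (u , v) ⊎-dec decode m (code u v) ≟ (v , u)) ×-dec
  (¬? (u Fin.≟ v) →-dec DecMembership._∈?_ ℕ._≟_ (code u v) (edgeCodes m))
  where _≟_ = ≡-dec Fin._≟_ Fin._≟_

-- The edge from `i` to `j` has a colour outside those of `ds`, which selects one of the searches in
-- `refutesAll`. The patterns are avoided because each comes from five distinct vertices, hence from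
-- an actual path or star.
fewColours : ∀ m .{{_ : NonZero m}} b ds (c : Fin m → Fin m → Fin k) → (∀ u v → c u v ≡ c v u) →
  Faithful m → Refuted m b ds →
  ¬ RainbowPath 5 c → ¬ MonoStar c →
  let f = λ e → uncurry c (decode m e) in
  Unique (map f ds) → ∀ {i j} → i ≢ j → c i j ∉ map f ds →
  ∃[ cs ] length cs ≤ b × (∀ u v → u ≢ v → c u v ∈ cs)
fewColours {k} m b ds c c-sym faithful (refuted evidence) noRainbow noMono ds! {i} {j} i≢j ij∉ds =
  few (refutes-sound f b (edgeCodes m) (code i j ∷ ds) avoidsP avoidsQ (fresh! ∷ ds!) refuted′)
  where
  f : ℕ → Fin k
  f e = uncurry c (decode m e)

  f-code : ∀ u v → f (code u v) ≡ c u v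
  f-code u v with proj₁ (faithful u v)
  ... | inj₁ eq = cong (uncurry c) eq
  ... | inj₂ eq = trans (cong (uncurry c) eq) (c-sym v u)

  fresh! : All (f (code i j) ≢_) (map f ds)
  fresh! = All.¬Any⇒All¬ _ (ij∉ds ∘ subst (_∈ map f ds) (f-code i j))

  refuted′ : T (refutes b (edgeCodes m) (pathPatterns m) (starPatterns m) (code i j ∷ ds))
  refuted′ with Equivalence.to (T-∨ {code i j ∈ᵇ ds})
                  (All.lookup (All.all⁺ _ (edgeCodes m) (Equivalence.from T-≡ evidence)) (proj₂ (faithful i j) i≢j))
  ... | inj₂ t = t
  ... | inj₁ t with d , d∈ds , eq ← find (Any.any⁻ (code i j ≡ᵇ_) ds t) =
    contradiction (cong f (ℕ.≡ᵇ⇒≡ (code i j) d eq)) (All.lookup (All.map⁻ fresh!) d∈ds)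

  avoidsP : All (NotRainbow f) (pathPatterns m)
  avoidsP = All.map⁺ (All.map (λ {p} p! es! → noRainbow (p , p! , subst Unique
    (trans (sym (map-∘ (pathEdges p))) (map-cong (uncurry f-code) (pathEdges p))) es!))
    (arrangements-unique m 5))

  avoidsQ : All (NotMono f) (starPatterns m)
  avoidsQ = All.map⁺ (All.map (λ {p} p! (a , es≡) → noMono (p , p! , a ,
    All.map (λ {e} → trans (sym (uncurry f-code e))) (All.map⁻ es≡)))
    (arrangements-unique m 5))

  few : FewColours f b (edgeCodes m) → ∃[ cs ] length cs ≤ b × (∀ u v → u ≢ v → c u v ∈ cs)
  few (cs , small , es∈cs) = cs , small , λ u v u≢v →
    subst (_∈ cs) (f-code u v) (All.lookup es∈cs (proj₂ (faithful u v) u≢v))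

-- 7, 13, 19 and 15, 22, 29 are the codes of the edges of the path on the last
-- four vertices of K₅ and K₆.
abstract
  faithful₅ : Faithful 5
  faithful₅ = from-yes (faithful? 5)

  faithful₆ : Faithful 6
  faithful₆ = from-yes (faithful? 6)

  refuted₅ : Refuted 5 5 (7 ∷ 13 ∷ 19 ∷ [])
  refuted₅ = refuted refl

  refuted₆ : Refuted 6 0 (15 ∷ 22 ∷ 29 ∷ [])
  refuted₆ = refuted refl

-- At least four colours

extend : (xs : Vec (Fin n) m) → Vec.Unique xs → m < n → ∃[ x ] Vec.Unique (x ∷ xs)
extend xs xs! m<n with x , x∉xs ← fresh xs m<n = x , x∉xs ∷ xs!

-- Places left over are filled by fresh vertices. Prepending keeps `xs` in the last positions, where
-- the codes of the path edges expect it.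
extend-to-contain : (xs : Vec (Fin n) m) → Vec.Unique xs → 2 + m ≤ n → ∀ y z →
  ∃[ p ] ∃[ q ] Vec.Unique (p ∷ q ∷ xs) × y Vec.∈ p ∷ q ∷ xs × z Vec.∈ p ∷ q ∷ xs
extend-to-contain xs xs! 2+m≤n y z with member y xs
... | inj₂ y∉xs with member z (y ∷ xs)
...   | inj₂ z∉ = z , y , z∉ ∷ y∉xs ∷ xs! , there (here refl) , here refl
...   | inj₁ z∈ with p , p! ← extend (y ∷ xs) (y∉xs ∷ xs!) 2+m≤n =
  p , y , p! , there (here refl) , there z∈
extend-to-contain xs xs! 2+m≤n y z | inj₁ y∈xs with member z xs
... | inj₂ z∉xs with p , p! ← extend (z ∷ xs) (z∉xs ∷ xs!) 2+m≤n =
  p , z , p! , there (there y∈xs) , there (here refl)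
... | inj₁ z∈xs with q , q! ← extend xs xs! (ℕ.<⇒≤ 2+m≤n)
                with p , p! ← extend (q ∷ xs) q! 2+m≤n =
  p , q , p! , there (there y∈xs) , there (there z∈xs)

module _ (col : ExactColouring k (K n)) where

  private
    c : Fin n → Fin n → Fin k
    c = colour col

    c-sym : ∀ u v → c u v ≡ c v u
    c-sym = colour-sym col

    c-flip : ∀ {u v a} → c u v ≡ a → c v u ≡ a
    c-flip = trans (c-sym _ _)

  -- Take edges `ab` and `pq` of colours α and β. If `a` and `p` differ, then either `ap` has colour
  -- α and differs from `pq` at `p`, or it differs from `ab` at `a`.
  two-coloured-vertex : 2 ≤ k →
    ∃[ v ] ∃[ x ] ∃[ y ] v ≢ x × v ≢ y × c v x ≢ c v y
  two-coloured-vertex 2≤k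
    with α , [] ← fresh {n = k} [] (ℕ.<⇒≤ 2≤k)
    with β , β≢α ∷ [] ← fresh (α ∷ []) 2≤k
    with a , b , a≢b , ab≡α ← exact col α | p , q , p≢q , pq≡β ← exact col β
    with a Fin.≟ p
  ... | yes refl = a , b , q , a≢b , p≢q , λ eq → β≢α (trans (sym pq≡β) (trans (sym eq) ab≡α))
  ... | no a≢p with c a p Fin.≟ α
  ...   | yes ap≡α = p , a , q , a≢p ∘ sym , p≢q ,
                     λ eq → β≢α (trans (sym pq≡β) (trans (sym eq) (c-flip ap≡α)))
  ...   | no ap≢α = a , b , p , a≢b , a≢p , λ eq → ap≢α (trans (sym eq) ab≡α)

  module _ (noPath : ¬ RainbowPath 4 c) where

    noPath′ : ∀ {a b d e} → a ≢ b → a ≢ d → a ≢ e → b ≢ d → b ≢ e → d ≢ e →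
      c a b ≢ c b d → c b d ≢ c d e → c a b ≡ c d e
    noPath′ {a} {b} {d} {e} a≢b a≢d a≢e b≢d b≢e d≢e ab≢bd bd≢de =
      decidable-stable (c a b Fin.≟ c d e) λ ab≢de → noPath
        (a ∷ b ∷ d ∷ e ∷ [] ,
         (a≢b ∷ a≢d ∷ a≢e ∷ []) ∷ (b≢d ∷ b≢e ∷ []) ∷ (d≢e ∷ []) ∷ [] ∷ [] ,
         (ab≢bd ∷ ab≢de ∷ []) ∷ (bd≢de ∷ []) ∷ [] ∷ [])

    module _ {v x y : Fin n} (v≢x : v ≢ x) (v≢y : v ≢ y) (vx≢vy : c v x ≢ c v y)
      {γ : Fin k} (γ≢vx : γ ≢ c v x) (γ≢vy : γ ≢ c v y) where

      private
        x≢y : x ≢ y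
        x≢y = vx≢vy ∘ cong (c v)

      module _ {w : Fin n} (w≢v : w ≢ v) (w≢x : w ≢ x) (w≢y : w ≢ y) where

        -- If `xy` differs from both `vw` and `vx`, the path `y x v w` is rainbow. If it has the
        -- colour of `vx`, then `x y v w` is rainbow, with the colours of `vx`, `vy` and γ.
        spoke-γ : c v w ≡ γ → c x y ≡ γ
        spoke-γ refl with c x y Fin.≟ c v w
        ... | yes eq = eq
        ... | no xy≢vw with c x y Fin.≟ c v x
        ... | no xy≢vx = contradiction
          (trans (c-sym x y) (noPath′ {y} {x} {v} {w} (x≢y ∘ sym) (v≢y ∘ sym) (w≢y ∘ sym) (v≢x ∘ sym) (w≢x ∘ sym) (w≢v ∘ sym)
            (λ eq → xy≢vx (trans (c-sym x y) (trans eq (c-sym x v)))) (λ eq → γ≢vx (sym (trans (c-sym v x) eq)))))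
          xy≢vw
        ... | yes xy≡vx = contradiction
          (noPath′ {x} {y} {v} {w} x≢y (v≢x ∘ sym) (w≢x ∘ sym) (v≢y ∘ sym) (w≢y ∘ sym) (w≢v ∘ sym)
            (λ eq → vx≢vy (trans (sym xy≡vx) (trans eq (c-sym y v)))) (λ eq → γ≢vy (sym (trans (c-sym v y) eq))))
          xy≢vw

        -- Otherwise the path `w x v y` would be rainbow, with γ and the colours of `vx` and `vy`.
        leaf-x : c x w ≢ γ
        leaf-x refl = γ≢vy (trans (c-sym x w)
          (noPath′ w≢x w≢v w≢y (v≢x ∘ sym) x≢y v≢y
            (λ eq → γ≢vx (trans (c-sym x w) (trans eq (c-sym x v)))) (λ eq → vx≢vy (trans (c-sym v x) eq))))

        leaf-y : c y w ≢ γ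
        leaf-y refl = γ≢vx (trans (c-sym y w)
          (noPath′ w≢y w≢v w≢x (v≢y ∘ sym) (x≢y ∘ sym) v≢x
            (λ eq → γ≢vy (trans (c-sym y w) (trans eq (c-sym y v)))) (λ eq → vx≢vy (sym (trans (c-sym v y) eq)))))

      -- An edge `zw` at `v` falls under `spoke-γ`; one that meets the triangle only in `x` or only
      -- in `y` is excluded by the leaf lemmas. If it misses all three vertices, either `vz` has
      -- colour γ, or one of `w z v x` and `w z v y` is rainbow.
      opposite-edge : ∀ {z w} → z ≢ w → c z w ≡ γ → c x y ≡ γ
      opposite-edge {z} {w} z≢w zw≡γ with z Fin.≟ v | w Fin.≟ v
      ... | yes refl | yes refl = contradiction refl z≢w
      ... | yes refl | no w≢v = spoke-γ w≢v
                                  (λ { refl → γ≢vx (sym zw≡γ) }) (λ { refl → γ≢vy (sym zw≡γ) }) zw≡γ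
      ... | no z≢v | yes refl = spoke-γ z≢v
                                  (λ { refl → γ≢vx (sym (c-flip zw≡γ)) })
                                  (λ { refl → γ≢vy (sym (c-flip zw≡γ)) }) (c-flip zw≡γ)
      ... | no z≢v | no w≢v with z Fin.≟ x | z Fin.≟ y | w Fin.≟ x | w Fin.≟ y
      ... | yes refl | _ | _ | yes refl = zw≡γ
      ... | yes refl | _ | _ | no w≢y = contradiction zw≡γ (leaf-x w≢v (z≢w ∘ sym) w≢y)
      ... | _ | yes refl | yes refl | _ = c-flip zw≡γ
      ... | _ | yes refl | no w≢x | _ = contradiction zw≡γ (leaf-y w≢v w≢x (z≢w ∘ sym))
      ... | no z≢x | no z≢y | yes refl | _ = contradiction (c-flip zw≡γ) (leaf-x z≢v z≢x z≢y)
      ... | no z≢x | no z≢y | no _ | yes refl = contradiction (c-flip zw≡γ) (leaf-y z≢v z≢x z≢y)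
      ... | no z≢x | no z≢y | no w≢x | no w≢y with c v z Fin.≟ γ
      ... | yes vz≡γ = spoke-γ z≢v z≢x z≢y vz≡γ
      ... | no vz≢γ with c v z Fin.≟ c v x
      ... | no vz≢vx = contradiction
        (trans (sym (c-flip zw≡γ)) (noPath′ (z≢w ∘ sym) w≢v w≢x z≢v z≢x v≢x
          (λ eq → vz≢γ (trans (c-sym v z) (trans (sym eq) (c-flip zw≡γ)))) (λ eq → vz≢vx (trans (c-sym v z) eq))))
        γ≢vx
      ... | yes vz≡vx = contradiction
        (trans (sym (c-flip zw≡γ)) (noPath′ (z≢w ∘ sym) w≢v w≢y z≢v z≢y v≢y
          (λ eq → vz≢γ (trans (c-sym v z) (trans (sym eq) (c-flip zw≡γ))))
          (λ eq → vx≢vy (trans (sym vz≡vx) (trans (c-sym v z) eq)))))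
        γ≢vy

  rainbowPath₄ : 4 ≤ k → RainbowPath 4 c
  rainbowPath₄ 4≤k = decidable-stable (rainbowPath? 4 c) λ noPath →
    let v , x , y , v≢x , v≢y , vx≢vy = two-coloured-vertex (ℕ.≤-trans (s≤s (s≤s z≤n)) 4≤k)
        forced = opposite-edge noPath v≢x v≢y vx≢vy
    in case v x y forced
    where
    case : ∀ v x y → (∀ {γ} → γ ≢ c v x → γ ≢ c v y → ∀ {z w} → z ≢ w → c z w ≡ γ → c x y ≡ γ) → _
    case v x y forced
      with γ , γ≢vx ∷ γ≢vy ∷ [] ← fresh (c v x ∷ c v y ∷ []) (ℕ.<⇒≤ 4≤k)
      with δ , δ≢γ ∷ δ≢vx ∷ δ≢vy ∷ [] ← fresh (γ ∷ c v x ∷ c v y ∷ []) 4≤k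
      with z , w , z≢w , zw≡γ ← exact col γ | z′ , w′ , z′≢w′ , zw′≡δ ← exact col δ =
      δ≢γ (trans (sym (forced δ≢vx δ≢vy z′≢w′ zw′≡δ)) (forced γ≢vx γ≢vy z≢w zw≡γ))

  module _ (noRainbow : ¬ RainbowPath 5 c) (noMono : ¬ MonoStar c) where

    abstract
      fewColours-on : ∀ m .{{_ : NonZero m}} b ds → Faithful m → Refuted m b ds →
        (vs : Vec (Fin n) m) → Vec.Unique vs →
        let c′ = λ u v → c (lookup vs u) (lookup vs v)
            es = map (λ e → uncurry c′ (decode m e)) ds in
        Unique es → ∀ {z w} → z Vec.∈ vs → w Vec.∈ vs → z ≢ w → c z w ∉ es →
        ∃[ cs ] length cs ≤ b × (∀ {u v} → u Vec.∈ vs → v Vec.∈ vs → u ≢ v → c u v ∈ cs)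
      fewColours-on m b ds faithful evidence vs vs! es! {z} {w} z∈ w∈ z≢w zw∉ =
        let z≡ = VecAny.lookup-index z∈
            w≡ = VecAny.lookup-index w∈
            cs , small , covers = fewColours m b ds c′ (λ _ _ → c-sym _ _) faithful evidence
              (noRainbow ∘ rainbowPath-lookup vs vs!) (noMono ∘ monoStar-lookup vs vs!) es!
              {Vec.index z∈} {Vec.index w∈}
              (λ eq → z≢w (trans z≡ (trans (cong (lookup vs) eq) (sym w≡))))
              (zw∉ ∘ subst (_∈ map (λ e → uncurry c′ (decode m e)) ds) (cong₂ c (sym z≡) (sym w≡)))
        in cs , small , λ u∈ v∈ u≢v →
          let u≡ = VecAny.lookup-index u∈
              v≡ = VecAny.lookup-index v∈
          in subst (_∈ cs) (cong₂ c (sym u≡) (sym v≡))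
               (covers (Vec.index u∈) (Vec.index v∈)
                 (λ eq → u≢v (trans u≡ (trans (cong (lookup vs) eq) (sym v≡)))))
        where
        c′ : Fin m → Fin m → Fin k
        c′ u v = c (lookup vs u) (lookup vs v)

    6≤n⇒⊥ : 4 ≤ k → 6 ≤ n → ⊥
    6≤n⇒⊥ 4≤k 6≤n
      with x₁ ∷ x₂ ∷ x₃ ∷ x₄ ∷ [] , xs! , es! ← rainbowPath₄ 4≤k
      with δ , δ≢₁₂ ∷ δ≢₂₃ ∷ δ≢₃₄ ∷ [] ← fresh (c x₁ x₂ ∷ c x₂ x₃ ∷ c x₃ x₄ ∷ []) 4≤k
      with z , w , z≢w , refl ← exact col δ
      with p , q , vs! , z∈ , w∈ ← extend-to-contain (x₁ ∷ x₂ ∷ x₃ ∷ x₄ ∷ []) xs! 6≤n z w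
      -- The bound 0 forces the list of colours to be empty, yet it has to contain the colour of
      -- `zw`.
      with [] , _ , covers ← fewColours-on 6 0 (15 ∷ 22 ∷ 29 ∷ []) faithful₆ refuted₆ _ vs! es! z∈ w∈ z≢w
             (All.All¬⇒¬Any (δ≢₁₂ ∷ δ≢₂₃ ∷ δ≢₃₄ ∷ []))
      with () ← covers z∈ w∈ z≢w

    n≤5⇒⊥ : 6 ≤ k → 5 ≤ n → n ≤ 5 → ⊥
    n≤5⇒⊥ 6≤k 5≤n n≤5
      with 4≤k ← ℕ.≤-trans (ℕ.m≤m+n 4 2) 6≤k
      with xs@(x₁ ∷ x₂ ∷ x₃ ∷ x₄ ∷ []) , xs! , es! ← rainbowPath₄ 4≤k
      with δ , δ≢₁₂ ∷ δ≢₂₃ ∷ δ≢₃₄ ∷ [] ← fresh (c x₁ x₂ ∷ c x₂ x₃ ∷ c x₃ x₄ ∷ []) 4≤k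
      with z , w , z≢w , refl ← exact col δ
      with y , vs! ← extend xs xs! 5≤n
      with vs∋ ← spanning vs! n≤5
      with cs , small , covers ← fewColours-on 5 5 (7 ∷ 13 ∷ 19 ∷ []) faithful₅ refuted₅
             _ vs! es! (vs∋ z) (vs∋ w) z≢w (All.All¬⇒¬Any (δ≢₁₂ ∷ δ≢₂₃ ∷ δ≢₃₄ ∷ []))
      -- The five vertices are the whole graph and carry at most five colours, so a colour ε outside
      -- `cs` has no edge.
      with ε , ε∉cs ← fresh (fromList cs) (ℕ.≤-trans (s≤s small) 6≤k)
      with u , v , u≢v , refl ← exact col ε =
      All.All¬⇒¬Any (VecAll.fromList⁻ ε∉cs) (covers (vs∋ u) (vs∋ v) u≢v)

  unavoidable : 4 ≤ k → 5 ≤ n → 6 ≤ n ⊎ 6 ≤ k → RainbowPath 5 c ⊎ MonoStar c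
  unavoidable 4≤k 5≤n large = decidable-stable (rainbowPath? 5 c ⊎-dec monoStar? c) λ avoids →
    cases (avoids ∘ inj₁) (avoids ∘ inj₂) large (6 ℕ.≤? n)
    where
    cases : ¬ RainbowPath 5 c → ¬ MonoStar c → 6 ≤ n ⊎ 6 ≤ k → Dec (6 ≤ n) → ⊥
    cases noRainbow noMono _ (yes 6≤n) = 6≤n⇒⊥ noRainbow noMono 4≤k 6≤n
    cases noRainbow noMono (inj₁ 6≤n) (no 6≰n) = 6≰n 6≤n
    cases noRainbow noMono (inj₂ 6≤k) (no 6≰n) = n≤5⇒⊥ noRainbow noMono 6≤k 5≤n (ℕ.≤-pred (ℕ.≰⇒> 6≰n))

-- Three colours

length-remove : (x : Fin n) {xs : List (Fin n)} → Unique xs → length xs ≤ suc (length (filter (x ≢?_) xs))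
length-remove x []           = z≤n
length-remove x (_∷_ {y} {ys} y∉ys ys!) with x Fin.≟ y
... | no  _    = s≤s (length-remove x ys!)
... | yes refl = s≤s (ℕ.≤-reflexive (cong length (sym (filter-all (x ≢?_) y∉ys))))

module _ {P : Pred A 0ℓ} (P? : Decidable P) where

  length-filter-∷ : ∀ x xs → length (filter P? xs) ≤ length (filter P? (x ∷ xs))
  length-filter-∷ x xs with does (P? x)
  ... | true = ℕ.n≤1+n _
  ... | false = ℕ.≤-refl

  length-filter-accept : ∀ {x} xs → P x → suc (length (filter P? xs)) ≤ length (filter P? (x ∷ xs))
  length-filter-accept {x} xs px with P? x
  ... | yes _ = ℕ.≤-refl
  ... | no ¬px = contradiction px ¬px

nonempty : (xs : List A) → 1 ≤ length xs → ∃[ x ] x ∈ xs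
nonempty (x ∷ xs) _ = x , here refl

Exhausts : (i j l : Fin k) → Set
Exhausts i j l = ∀ a → a ≡ i ⊎ a ≡ j ⊎ a ≡ l

third-colour : ∀ {i j l a : Fin k} → Exhausts i j l → a ≢ i → a ≢ j → a ≡ l
third-colour {a = a} exh a≢i a≢j with exh a
... | inj₁ a≡i        = contradiction a≡i a≢i
... | inj₂ (inj₁ a≡j) = contradiction a≡j a≢j
... | inj₂ (inj₂ a≡l) = a≡l

swap₂₃ : ∀ {i j l : Fin k} → Exhausts i j l → Exhausts i l j
swap₂₃ exh a with exh a
... | inj₁ p        = inj₁ p
... | inj₂ (inj₁ p) = inj₂ (inj₂ p)
... | inj₂ (inj₂ p) = inj₂ (inj₁ p)

colour-count : ∀ {i j l : Fin k} → Exhausts i j l → (g : A → Fin k) (xs : List A) →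
  length xs ≤ length (filter (λ x → g x Fin.≟ i) xs) + length (filter (λ x → g x Fin.≟ j) xs)
            + length (filter (λ x → g x Fin.≟ l) xs)
colour-count exh g [] = z≤n
colour-count {i = i} {j} {l} exh g (x ∷ xs) with exh (g x)
... | inj₁ gx≡i = ℕ.≤-trans (s≤s (colour-count exh g xs))
  (ℕ.+-mono-≤ (ℕ.+-mono-≤ (length-filter-accept (λ x → g x Fin.≟ i) xs gx≡i)
    (length-filter-∷ (λ x → g x Fin.≟ j) x xs)) (length-filter-∷ (λ x → g x Fin.≟ l) x xs))
... | inj₂ (inj₁ gx≡j) = ℕ.≤-trans (s≤s (colour-count exh g xs)) (ℕ.≤-trans
  (ℕ.≤-reflexive (cong (_+ length (filter (λ x → g x Fin.≟ l) xs)) (sym (ℕ.+-suc _ _))))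
  (ℕ.+-mono-≤ (ℕ.+-mono-≤ (length-filter-∷ (λ x → g x Fin.≟ i) x xs)
    (length-filter-accept (λ x → g x Fin.≟ j) xs gx≡j)) (length-filter-∷ (λ x → g x Fin.≟ l) x xs)))
... | inj₂ (inj₂ gx≡l) = ℕ.≤-trans (s≤s (colour-count exh g xs)) (ℕ.≤-trans
  (ℕ.≤-reflexive (sym (ℕ.+-suc _ _)))
  (ℕ.+-mono-≤ (ℕ.+-mono-≤ (length-filter-∷ (λ x → g x Fin.≟ i) x xs)
    (length-filter-∷ (λ x → g x Fin.≟ j) x xs)) (length-filter-accept (λ x → g x Fin.≟ l) xs gx≡l)))

module _ (c : Fin n → Fin n → Fin 3) (c-sym : ∀ u v → c u v ≡ c v u) (noMono : ¬ MonoStar c) where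

  -- Relative to a vertex list, so that degrees can also be counted inside a neighbourhood.
  Γ : Fin 3 → Fin n → List (Fin n) → List (Fin n)
  Γ i v L = filter (λ u → c v u Fin.≟ i) (filter (v ≢?_) L)

  module _ {i : Fin 3} {v : Fin n} {L : List (Fin n)} where

    Γ⁻ : ∀ {u} → u ∈ Γ i v L → u ∈ L × v ≢ u × c v u ≡ i
    Γ⁻ u∈ with u∈′ , vu≡i ← ∈-filter⁻ (λ u → c v u Fin.≟ i) u∈
          with u∈L , v≢u ← ∈-filter⁻ (v ≢?_) u∈′ = u∈L , v≢u , vu≡i

    Γ⁺ : ∀ {u} → u ∈ L → v ≢ u → c v u ≡ i → u ∈ Γ i v L
    Γ⁺ u∈L v≢u vu≡i = ∈-filter⁺ (λ u → c v u Fin.≟ i) (∈-filter⁺ (v ≢?_) u∈L v≢u) vu≡i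

    Γ! : Unique L → Unique (Γ i v L)
    Γ! L! = Unique.filter⁺ (λ u → c v u Fin.≟ i) (Unique.filter⁺ (v ≢?_) L!)

  -- The `suc` accounts for `v` itself, in case it lies in `L`.
  degree-sum : ∀ {i j l} → Exhausts i j l → ∀ v {L} → Unique L →
    length L ≤ suc (length (Γ i v L) + length (Γ j v L) + length (Γ l v L))
  degree-sum exh v {L} L! = ℕ.≤-trans (length-remove v L!) (s≤s (colour-count exh (c v) (filter (v ≢?_) L)))

  Avoids : Fin 3 → List (Fin n) → Set
  Avoids i L = ∀ {x y} → x ∈ L → y ∈ L → x ≢ y → c x y ≢ i

  -- An edge `xy` of colour `i` inside the neighbourhood, with two more neighbours as leaves, would
  -- give an S₅¹ with centre `v`.
  large-neighbourhood-avoids : ∀ {i v L} → Unique L → 4 ≤ length (Γ i v L) → Avoids i (Γ i v L)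
  large-neighbourhood-avoids {i} {v} {L} L! 4≤ {x} {y} x∈ y∈ x≢y xy≡i = star M M! M⁻ 2≤M
    where
    M : List (Fin n)
    M = filter (y ≢?_) (filter (x ≢?_) (Γ i v L))

    M! : Unique M
    M! = Unique.filter⁺ (y ≢?_) (Unique.filter⁺ (x ≢?_) (Γ! L!))

    M⁻ : ∀ {z} → z ∈ M → v ≢ z × c v z ≡ i × x ≢ z × y ≢ z
    M⁻ z∈ with z∈′ , y≢z ← ∈-filter⁻ (y ≢?_) z∈ with z∈″ , x≢z ← ∈-filter⁻ (x ≢?_) z∈′
          with _ , v≢z , vz≡i ← Γ⁻ {i} {v} {L} z∈″ = v≢z , vz≡i , x≢z , y≢z

    2≤M : 2 ≤ length M
    2≤M = ℕ.≤-pred (ℕ.≤-trans (ℕ.≤-pred (ℕ.≤-trans 4≤ (length-remove x (Γ! L!))))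
      (length-remove y (Unique.filter⁺ (x ≢?_) (Γ! L!))))

    star : ∀ M → Unique M → (∀ {z} → z ∈ M → v ≢ z × c v z ≡ i × x ≢ z × y ≢ z) → 2 ≤ length M → ⊥
    star (_ ∷ []) _ _ (s≤s ())
    star (z ∷ w ∷ _) ((z≢w ∷ _) ∷ _) M⁻ _
      with _ , v≢x , vx≡i ← Γ⁻ {i} {v} {L} x∈ | _ , v≢y , vy≡i ← Γ⁻ {i} {v} {L} y∈
         | v≢z , vz≡i , x≢z , y≢z ← M⁻ (here refl) | v≢w , vw≡i , x≢w , y≢w ← M⁻ (there (here refl)) =
      noMono (v ∷ x ∷ y ∷ z ∷ w ∷ [] ,
        (v≢x ∷ v≢y ∷ v≢z ∷ v≢w ∷ []) ∷ (x≢y ∷ x≢z ∷ x≢w ∷ []) ∷ (y≢z ∷ y≢w ∷ []) ∷ (z≢w ∷ []) ∷ [] ∷ [] ,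
        i , vx≡i ∷ vy≡i ∷ vz≡i ∷ vw≡i ∷ xy≡i ∷ [])

  triangle-free : ∀ {i v L} → Unique L → 4 ≤ length (Γ i v L) → ∀ {x y} → x ∈ L → y ∈ L →
    v ≢ x → v ≢ y → x ≢ y → c v x ≡ i → c v y ≡ i → c x y ≢ i
  triangle-free L! 4≤ x∈L y∈L v≢x v≢y x≢y vx≡i vy≡i =
    large-neighbourhood-avoids L! 4≤ (Γ⁺ x∈L v≢x vx≡i) (Γ⁺ y∈L v≢y vy≡i) x≢y

  no-mono-K₅ : ∀ {l M} → Unique M → (∀ {x y} → x ∈ M → y ∈ M → x ≢ y → c x y ≡ l) → length M ≤ 4
  no-mono-K₅ {M = []} M! mono = z≤n
  no-mono-K₅ {M = _ ∷ []} M! mono = s≤s z≤n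
  no-mono-K₅ {M = _ ∷ _ ∷ []} M! mono = s≤s (s≤s z≤n)
  no-mono-K₅ {M = _ ∷ _ ∷ _ ∷ []} M! mono = s≤s (s≤s (s≤s z≤n))
  no-mono-K₅ {M = _ ∷ _ ∷ _ ∷ _ ∷ []} M! mono = s≤s (s≤s (s≤s (s≤s z≤n)))
  no-mono-K₅ {l} {v ∷ x ∷ y ∷ z ∷ w ∷ _}
    ((v≢x ∷ v≢y ∷ v≢z ∷ v≢w ∷ _) ∷ (x≢y ∷ x≢z ∷ x≢w ∷ _) ∷ (y≢z ∷ y≢w ∷ _) ∷ (z≢w ∷ _) ∷ _) mono =
    ⊥-elim (noMono (v ∷ x ∷ y ∷ z ∷ w ∷ [] ,
        (v≢x ∷ v≢y ∷ v≢z ∷ v≢w ∷ []) ∷ (x≢y ∷ x≢z ∷ x≢w ∷ []) ∷ (y≢z ∷ y≢w ∷ []) ∷ (z≢w ∷ []) ∷ [] ∷ [] ,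
        l , mono v∈ x∈ v≢x ∷ mono v∈ y∈ v≢y ∷ mono v∈ z∈ v≢z ∷ mono v∈ w∈ v≢w ∷ mono x∈ y∈ x≢y ∷ []))
    where
    v∈ = here refl
    x∈ = there (here refl)
    y∈ = there (there (here refl))
    z∈ = there (there (there (here refl)))
    w∈ = there (there (there (there (here refl))))

  Γ-avoided-empty : ∀ {i v L} → Avoids i L → v ∈ L → length (Γ i v L) ≡ 0
  Γ-avoided-empty {i} {v} {L} avoids v∈L with Γ i v L in eq
  ... | [] = refl
  ... | u ∷ us with u∈L , v≢u , vu≡i ← Γ⁻ {i} {v} {L} (subst (u ∈_) (sym eq) (here refl)) =
    contradiction vu≡i (avoids v∈L u∈L v≢u)

  degree-sum₂ : ∀ {i j l} → Exhausts i j l → ∀ {v L} → Unique L → Avoids i L → v ∈ L →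
    length L ≤ suc (length (Γ j v L) + length (Γ l v L))
  degree-sum₂ {j = j} {l} exh {v} {L} L! avoids v∈L = ℕ.≤-trans (degree-sum exh v L!)
    (ℕ.≤-reflexive (cong (λ d → suc (d + length (Γ j v L) + length (Γ l v L))) (Γ-avoided-empty avoids v∈L)))

  module _ {i L} (L! : Unique L) (avoids : Avoids i L) (9≤L : 9 ≤ length L) where

    private
      -- A larger `j`-neighbourhood contains neither colour `i` nor colour `j`, so it would be a
      -- clique of colour `l`, and K₅ contains S₅¹.
      degree≤4 : ∀ {j l} → Exhausts i j l → ∀ {v} → length (Γ j v L) ≤ 4
      degree≤4 {j} exh {v} with length (Γ j v L) ≤? 4
      ... | yes p = p
      ... | no  p = no-mono-K₅ (Γ! L!) λ x∈ y∈ x≢y →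
        third-colour exh (avoids (proj₁ (Γ⁻ {j} {v} {L} x∈)) (proj₁ (Γ⁻ {j} {v} {L} y∈)) x≢y)
          (large-neighbourhood-avoids L! (ℕ.<⇒≤ (ℕ.≰⇒> p)) x∈ y∈ x≢y)

      4≤degree : ∀ {j l} → Exhausts i j l → ∀ {v} → v ∈ L → 4 ≤ length (Γ j v L)
      4≤degree {j} {l} exh {v} v∈L = ℕ.+-cancelʳ-≤ 4 4 _ (ℕ.≤-trans
        (ℕ.≤-pred (ℕ.≤-trans 9≤L (degree-sum₂ exh L! avoids v∈L)))
        (ℕ.+-monoʳ-≤ (length (Γ j v L)) (degree≤4 (swap₂₃ exh))))

    -- Three `j`-neighbours of `v` are pairwise joined in colour `l`; but each has `l`-degree at
    -- least 4 and so lies on no `l`-triangle.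
    two-coloured⇒⊥ : ∀ {j l} → Exhausts i j l → ⊥
    two-coloured⇒⊥ {j} {l} exh with nonempty L (ℕ.≤-trans (s≤s z≤n) 9≤L)
    ... | v , v∈L with Γ j v L in eq | 4≤degree exh {v} v∈L | Γ! {j} {v} L!
    ...   | _ ∷ []     | s≤s () | _
    ...   | _ ∷ _ ∷ [] | s≤s (s≤s ()) | _
    ...   | x ∷ y ∷ z ∷ M | _ | (x≢y ∷ x≢z ∷ _) ∷ (y≢z ∷ _) ∷ _ =
        triangle-free L! (4≤degree (swap₂₃ exh) (∈L x∈)) (∈L y∈) (∈L z∈) x≢y x≢z y≢z
          (colour-l x∈ y∈ x≢y) (colour-l x∈ z∈ x≢z) (colour-l y∈ z∈ y≢z)
        where
        x∈ : x ∈ Γ j v L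
        x∈ = subst (x ∈_) (sym eq) (here refl)
        y∈ : y ∈ Γ j v L
        y∈ = subst (y ∈_) (sym eq) (there (here refl))
        z∈ : z ∈ Γ j v L
        z∈ = subst (z ∈_) (sym eq) (there (there (here refl)))
        ∈L : ∀ {u} → u ∈ Γ j v L → u ∈ L
        ∈L u∈ = proj₁ (Γ⁻ {j} {v} {L} u∈)
        colour-l : ∀ {u w} → u ∈ Γ j v L → w ∈ Γ j v L → u ≢ w → c u w ≡ l
        colour-l u∈ w∈ u≢w = third-colour exh (avoids (∈L u∈) (∈L w∈) u≢w)
          (large-neighbourhood-avoids L! (4≤degree exh {v} v∈L) u∈ w∈ u≢w)

  module _ (21≤n : 21 ≤ n) where

    private
      V : List (Fin n)
      V = allFin n

      V! : Unique V
      V! = Unique.allFin⁺ n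

      others : ∀ i → ∃[ j ] ∃[ l ] Exhausts {3} i j l
      others zero = suc zero , suc (suc zero) , λ where
        zero → inj₁ refl
        (suc zero) → inj₂ (inj₁ refl)
        (suc (suc zero)) → inj₂ (inj₂ refl)
      others (suc zero) = zero , suc (suc zero) , λ where
        zero → inj₂ (inj₁ refl)
        (suc zero) → inj₁ refl
        (suc (suc zero)) → inj₂ (inj₂ refl)
      others (suc (suc zero)) = zero , suc zero , λ where
        zero → inj₂ (inj₁ refl)
        (suc zero) → inj₂ (inj₂ refl)
        (suc (suc zero)) → inj₁ refl

      total-degree : ∀ {i j l} → Exhausts i j l → ∀ v →
        20 ≤ length (Γ i v V) + length (Γ j v V) + length (Γ l v V)
      total-degree exh v = ℕ.≤-pred (ℕ.≤-trans (subst (21 ≤_) (sym (length-tabulate {n = n} (λ u → u))) 21≤n)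
        (degree-sum exh v V!))

      degree≤8 : ∀ i v → length (Γ i v V) ≤ 8
      degree≤8 i v with length (Γ i v V) ≤? 8 | others i
      ... | yes p | _ = p
      ... | no  p | j , l , exh = ⊥-elim (two-coloured⇒⊥ (Γ! V!)
        (large-neighbourhood-avoids V! (ℕ.≤-trans (ℕ.m≤m+n 4 5) (ℕ.≰⇒> p))) (ℕ.≰⇒> p) exh)

      4≤degree : ∀ i v → 4 ≤ length (Γ i v V)
      4≤degree i v with j , l , exh ← others i =
        -- The other two colours take at most 8 each of the at least 20 edges at `v`.
        ℕ.+-cancelʳ-≤ 8 4 _ (ℕ.+-cancelʳ-≤ 8 12 _ (ℕ.≤-trans (total-degree exh v)
          (ℕ.+-mono-≤ (ℕ.+-monoʳ-≤ (length (Γ i v V)) (degree≤8 j v)) (degree≤8 l v))))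

      no-triangle : ∀ {i x y z} → x ≢ y → x ≢ z → y ≢ z → c x y ≡ i → c x z ≡ i → c y z ≢ i
      no-triangle {i} {x} = triangle-free V! (4≤degree i x) (∈-allFin _) (∈-allFin _)

      -- Three `j`-neighbours of `v` in `L` would form a triangle of colour `l`: colour `i` is
      -- avoided in `L`, and `j` would close a triangle with `v`.
      degree≤2 : ∀ {i j l} → Exhausts i j l → ∀ {v L} → Unique L → Avoids i L → length (Γ j v L) ≤ 2
      degree≤2 {i} {j} {l} exh {v} {L} L! avoids with Γ j v L in eq | Γ! {j} {v} L!
      ... | []          | _ = z≤n
      ... | _ ∷ []      | _ = s≤s z≤n
      ... | _ ∷ _ ∷ []  | _ = s≤s (s≤s z≤n)
      ... | x ∷ y ∷ z ∷ M | (x≢y ∷ x≢z ∷ _) ∷ (y≢z ∷ _) ∷ _ =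
        contradiction (colour-l y∈ z∈ y≢z) (no-triangle x≢y x≢z y≢z (colour-l x∈ y∈ x≢y) (colour-l x∈ z∈ x≢z))
        where
        x∈ : x ∈ Γ j v L
        x∈ = subst (x ∈_) (sym eq) (here refl)
        y∈ : y ∈ Γ j v L
        y∈ = subst (y ∈_) (sym eq) (there (here refl))
        z∈ : z ∈ Γ j v L
        z∈ = subst (z ∈_) (sym eq) (there (there (here refl)))
        colour-l : ∀ {u w} → u ∈ Γ j v L → w ∈ Γ j v L → u ≢ w → c u w ≡ l
        colour-l u∈ w∈ u≢w
          with u∈L , v≢u , vu≡j ← Γ⁻ {j} {v} {L} u∈ | w∈L , v≢w , vw≡j ← Γ⁻ {j} {v} {L} w∈ =
          third-colour exh (avoids u∈L w∈L u≢w) (no-triangle v≢u v≢w u≢w vu≡j vw≡j)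

      -- This is R(3, 3) = 6: only two colours occur on `L`, without a monochromatic triangle, so a
      -- vertex has at most 2 + 2 neighbours there.
      avoiding-bound : ∀ {i} L → Unique L → Avoids i L → length L ≤ 5
      avoiding-bound [] L! avoids = z≤n
      avoiding-bound {i} (v ∷ L) L! avoids with j , l , exh ← others i =
        ℕ.≤-trans (degree-sum₂ exh L! avoids (here refl))
          (s≤s (ℕ.+-mono-≤ (degree≤2 exh {v} L! avoids) (degree≤2 (swap₂₃ exh) {v} L! avoids)))

      degree≤5 : ∀ i v → length (Γ i v V) ≤ 5
      degree≤5 i v = avoiding-bound _ (Γ! V!) (large-neighbourhood-avoids V! (4≤degree i v))

    21≤n⇒⊥ : ⊥
    21≤n⇒⊥ with _ , _ , exh ← others zero =
      -- Three degrees of at most 5 add up to at most 15, against 20.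
      ℕ.<⇒≱ (ℕ.m≤m+n 16 4) (ℕ.≤-trans (total-degree exh v)
        (ℕ.+-mono-≤ (ℕ.+-mono-≤ (degree≤5 _ v) (degree≤5 _ v)) (degree≤5 _ v)))
      where
      v : Fin n
      v = Fin.fromℕ< (ℕ.≤-trans (s≤s z≤n) 21≤n)

monoStar₃ : (col : ExactColouring 3 (K n)) → 21 ≤ n → MonoStar (colour col)
monoStar₃ col 21≤n = decidable-stable (monoStar? (colour col)) λ noMono →
  21≤n⇒⊥ (colour col) (colour-sym col) noMono 21≤n

-- Extremal colourings

module _ (col : ExactColouring k (K n)) (f : Copy (P 5) (K n)) where

  pathColour : Fin 4 → Fin k
  pathColour i = colour col (to f (inject₁ i)) (to f (suc i))

  pathColour-injective : Rainbow col f → ∀ i j → pathColour i ≡ pathColour j → i ≡ j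
  pathColour-injective rainbow i j eq
    with rainbow {inject₁ i} {suc i} {inject₁ j} {suc j} (fwd (step i)) (fwd (step j)) eq
    where
    step : ∀ (i : Fin 4) → toℕ (Fin.suc i) ≡ suc (toℕ (inject₁ i))
    step i = cong suc (sym (Fin.toℕ-inject₁ i))
  ... | inj₁ (_ , si≡sj) = Fin.suc-injective si≡sj
  ... | inj₂ (i≡sj , si≡j) = contradiction
    (trans (cong suc (sym (trans (sym (Fin.toℕ-inject₁ i)) (cong toℕ i≡sj))))
      (trans (cong toℕ si≡j) (Fin.toℕ-inject₁ j)))
    (ℕ.<⇒≢ (ℕ.m<n⇒m<1+n ℕ.≤-refl) ∘ sym)

Avoiding : ExactColouring k (K n) → Set
Avoiding {n = n} col = (∀ (f : Copy (P 5) (K n)) → ¬ Rainbow col f) ×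
                       (∀ (f : Copy (S 5 1) (K n)) → ¬ Monochromatic col f)

-- The bound quantifies over all orders from `y` on, so one avoiding colouring of `K n` excludes
-- every `y ≤ n`.
lower-bound : (col : ExactColouring k (K n)) → Avoiding col →
  ∀ y → GRBound k (P 5) (S 5 1) y → suc n ≤ y
lower-bound {n = n} col (noRainbow , noMono) y (_ , bound) = ℕ.≰⇒> λ y≤n →
  [ (λ (f , rainbow) → noRainbow f rainbow) , (λ (f , mono) → noMono f mono) ]′ (bound n y≤n col)

-- K₅ is the union of two 5-cycles, in colours 1 and 2; every vertex is then
-- replaced by a K₄ in colour 0.
cycleColour : Fin 5 → Fin 5 → Fin 3
cycleColour x y = lookup (# 0 ∷ # 1 ∷ # 2 ∷ # 2 ∷ # 1 ∷ []) (Fin.fromℕ< {∣ toℕ x - toℕ y ∣}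
  (ℕ.≤-<-trans (ℕ.∣m-n∣≤m⊔n (toℕ x) (toℕ y)) (ℕ.⊔-lub (Fin.toℕ<n x) (Fin.toℕ<n y))))

cycleColour-sym : ∀ x y → cycleColour x y ≡ cycleColour y x
cycleColour-sym = from-yes (Fin.all? λ x → Fin.all? λ y → cycleColour x y Fin.≟ cycleColour y x)

cycleColour≡0⇒≡ : ∀ x y → cycleColour x y ≡ # 0 → x ≡ y
cycleColour≡0⇒≡ = from-yes (Fin.all? λ x → Fin.all? λ y → (cycleColour x y Fin.≟ # 0) →-dec (x Fin.≟ y))

-- A 5-cycle has no triangle, so three equal colours occur only when the vertices coincide.
cycleColour-triangle : ∀ x y z → cycleColour x y ≡ cycleColour x z → cycleColour x y ≡ cycleColour y z →
  cycleColour x y ≡ # 0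
cycleColour-triangle = from-yes (Fin.all? λ x → Fin.all? λ y → Fin.all? λ z →
  (cycleColour x y Fin.≟ cycleColour x z) →-dec (cycleColour x y Fin.≟ cycleColour y z) →-dec
  (cycleColour x y Fin.≟ # 0))

block : Fin 20 → Fin 5
block = Fin.quotient {5} 4

blowUp : ExactColouring 3 (K 20)
blowUp .colour u v = cycleColour (block u) (block v)
blowUp .colour-sym u v = cycleColour-sym (block u) (block v)
blowUp .exact zero = # 0 , # 1 , (λ ()) , refl
blowUp .exact (suc zero) = # 0 , # 4 , (λ ()) , refl
blowUp .exact (suc (suc zero)) = # 0 , # 8 , (λ ()) , refl

hub : ∀ {v : Fin 4} → Adj (S 5 1) zero (suc v)
hub = fwd (spoke refl λ ())

rim : Adj (S 5 1) (# 1) (# 2)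
rim = fwd (extra 0 (s≤s z≤n) refl refl)

blowUp-avoiding : Avoiding blowUp
-- Four path edges cannot have different colours out of three.
blowUp-avoiding .proj₁ f rainbow = ℕ.1+n≰n
  (Fin.injective⇒≤ {f = pathColour blowUp f} (pathColour-injective blowUp f rainbow _ _))
-- The triangle of the star forces colour 0, so all five vertices would lie in one block of four.
blowUp-avoiding .proj₂ f (a , mono) = ℕ.1+n≰n (Fin.injective⇒≤ remainder-injective)
  where
  b : Fin 5 → Fin 5
  b = block ∘ to f

  a≡0 : a ≡ # 0
  a≡0 = trans (sym (mono (hub {# 0}))) (cycleColour-triangle (b (# 0)) (b (# 1)) (b (# 2))
    (trans (mono hub) (sym (mono hub))) (trans (mono hub) (sym (mono rim))))

  same-block : ∀ i → b zero ≡ b i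
  same-block zero    = refl
  same-block (suc i) = cycleColour≡0⇒≡ _ _ (trans (mono hub) a≡0)

  remainder-injective : Injective _≡_ _≡_ (Fin.remainder {5} 4 ∘ to f)
  remainder-injective {i} {j} eq = injective f (trans (sym (Fin.combine-remQuot {5} 4 (to f i)))
    (trans (cong₂ Fin.combine (trans (sym (same-block i)) (same-block j)) eq) (Fin.combine-remQuot {5} 4 (to f j))))

-- K₄ in colour 0 together with a vertex whose edges to it avoid colour 0.
module _ (h : Fin 4 → Fin k) (preimage : ∀ a → ∃[ x ] h x ≡ a)
  (no-triple : ∀ x y z → h x ≡ h y → h x ≡ h z → x ≡ y ⊎ x ≡ z ⊎ y ≡ z) where

  coned : ExactColouring (suc k) (K 5)
  coned .colour zero    zero    = zero
  coned .colour zero    (suc v) = suc (h v)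
  coned .colour (suc u) zero    = suc (h u)
  coned .colour (suc u) (suc v) = zero
  coned .colour-sym zero    zero    = refl
  coned .colour-sym zero    (suc v) = refl
  coned .colour-sym (suc u) zero    = refl
  coned .colour-sym (suc u) (suc v) = refl
  coned .exact zero = # 1 , # 2 , (λ ()) , refl
  coned .exact (suc a) with x , hx≡a ← preimage a = zero , suc x , (λ ()) , cong suc hx≡a

  coned-zero : ∀ {u v} → u ≢ zero → v ≢ zero → colour coned u v ≡ zero
  coned-zero {zero}          u≢0 v≢0 = contradiction refl u≢0
  coned-zero {suc u} {zero}  u≢0 v≢0 = contradiction refl v≢0
  coned-zero {suc u} {suc v} u≢0 v≢0 = refl

  coned-avoiding : Avoiding coned
  -- The cone vertex `zero` lies on at most two of the four path edges, and the others share colour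
  -- 0.
  coned-avoiding .proj₁ f rainbow = cases (to f (# 0) Fin.≟ zero) (to f (# 1) Fin.≟ zero) (to f (# 2) Fin.≟ zero)
    where
    apart : ∀ {i j} → to f i ≡ zero → i ≢ j → to f j ≢ zero
    apart fi≡0 i≢j fj≡0 = i≢j (injective f (trans fi≡0 (sym fj≡0)))

    both-zero : ∀ i j → i ≢ j → to f (inject₁ i) ≢ zero → to f (suc i) ≢ zero →
      to f (inject₁ j) ≢ zero → to f (suc j) ≢ zero → ⊥
    both-zero i j i≢j p q p′ q′ = i≢j (pathColour-injective coned f rainbow i j
      (trans (coned-zero p q) (sym (coned-zero p′ q′))))

    cases : Dec (to f (# 0) ≡ zero) → Dec (to f (# 1) ≡ zero) → Dec (to f (# 2) ≡ zero) → ⊥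
    cases _ _ (yes f₂) = both-zero (# 0) (# 3) (λ ())
      (apart f₂ λ ()) (apart f₂ λ ()) (apart f₂ λ ()) (apart f₂ λ ())
    cases _ (yes f₁) (no f₂) = both-zero (# 2) (# 3) (λ ()) f₂ (apart f₁ λ ()) (apart f₁ λ ()) (apart f₁ λ ())
    cases (yes f₀) (no f₁) (no f₂) = both-zero (# 1) (# 2) (λ ()) f₁ f₂ f₂ (apart f₀ λ ())
    cases (no f₀) (no f₁) (no f₂) = both-zero (# 0) (# 1) (λ ()) f₀ f₁ f₁ f₂
  coned-avoiding .proj₂ f (a , mono) with Fin.any? (λ i → to f i Fin.≟ zero)
  ... | no all≢0 = ℕ.1+n≰n (Fin.injective⇒≤ {f = λ i → Fin.punchOut (0≢f i)} λ {i} {j} eq →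
    injective f (Fin.punchOut-injective (0≢f i) (0≢f j) eq))
    where
    0≢f : ∀ i → zero ≢ to f i
    0≢f i 0≡ = all≢0 (i , sym 0≡)
  -- With the centre at the cone vertex, three spokes of one colour contradict `no-triple`.
  ... | yes (zero , f₀≡0) = no-three (spokes (# 0)) (spokes (# 1)) (spokes (# 2))
    where
    spokes : ∀ i → ∃[ x ] to f (suc i) ≡ suc x × suc (h x) ≡ a
    spokes i with to f (suc i) in eq | mono (hub {i})
    ... | zero  | _ = contradiction (injective f (trans f₀≡0 (sym eq))) λ ()
    ... | suc x | e = x , refl , trans (cong (λ u → colour coned u (suc x)) (sym f₀≡0)) e
    no-three : ∃[ x ] to f (# 1) ≡ suc x × suc (h x) ≡ a → ∃[ x ] to f (# 2) ≡ suc x × suc (h x) ≡ a →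
      ∃[ x ] to f (# 3) ≡ suc x × suc (h x) ≡ a → ⊥
    no-three (x , fx , hx) (y , fy , hy) (z , fz , hz)
      with no-triple x y z (Fin.suc-injective (trans hx (sym hy))) (Fin.suc-injective (trans hx (sym hz)))
    ... | inj₁ refl = contradiction (injective f (trans fx (sym fy))) λ ()
    ... | inj₂ (inj₁ refl) = contradiction (injective f (trans fx (sym fz))) λ ()
    ... | inj₂ (inj₂ refl) = contradiction (injective f (trans fy (sym fz))) λ ()
  -- With a leaf at the cone vertex, its spoke avoids colour 0 while every other spoke has it; one
  -- of the first two leaves is such another.
  ... | yes (suc i , fi≡0) = rest (# 0) (# 1) (λ ())
    where
    f₀≢0 : to f zero ≢ zero
    f₀≢0 f₀≡0 = contradiction (injective f (trans f₀≡0 (sym fi≡0))) λ ()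

    a≢0 : a ≢ zero
    a≢0 a≡0 with to f zero in eq | mono (hub {i})
    ... | zero  | _ = f₀≢0 eq
    ... | suc w | e = contradiction (trans (sym (cong (colour coned (suc w)) fi≡0)) (trans e a≡0)) λ ()

    rest : ∀ (j l : Fin 4) → j ≢ l → ⊥
    rest j l j≢l with i Fin.≟ j
    ... | no i≢j = a≢0 (trans (sym (mono (hub {j}))) (coned-zero f₀≢0
      λ fj≡0 → i≢j (Fin.suc-injective (injective f (trans fi≡0 (sym fj≡0))))))
    ... | yes refl = a≢0 (trans (sym (mono (hub {l}))) (coned-zero f₀≢0
      λ fl≡0 → j≢l (Fin.suc-injective (injective f (trans fi≡0 (sym fl≡0))))))

coned₄ : ∃[ col ] Avoiding {4} {5} col
coned₄ = coned h (λ a → onto a) (triples) , coned-avoiding h onto triples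
  where
  h : Fin 4 → Fin 3
  h = lookup (# 0 ∷ # 1 ∷ # 2 ∷ # 2 ∷ [])
  onto : ∀ a → ∃[ x ] h x ≡ a
  onto = from-yes (Fin.all? λ a → Fin.any? λ x → h x Fin.≟ a)
  triples : ∀ x y z → h x ≡ h y → h x ≡ h z → x ≡ y ⊎ x ≡ z ⊎ y ≡ z
  triples = from-yes (Fin.all? λ x → Fin.all? λ y → Fin.all? λ z →
    (h x Fin.≟ h y) →-dec (h x Fin.≟ h z) →-dec (x Fin.≟ y ⊎-dec x Fin.≟ z ⊎-dec y Fin.≟ z))

coned₅ : ∃[ col ] Avoiding {5} {5} col
coned₅ = coned (λ x → x) onto triples , coned-avoiding (λ x → x) onto triples
  where
  onto : ∀ (a : Fin 4) → ∃[ x ] x ≡ a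
  onto a = a , refl
  triples : ∀ (x y z : Fin 4) → x ≡ y → x ≡ z → x ≡ y ⊎ x ≡ z ⊎ y ≡ z
  triples x y z x≡y _ = inj₁ x≡y

rainbowK₄ : ExactColouring 6 (K 4)
rainbowK₄ = record
  { colour     = colour₄
  ; colour-sym = from-yes (Fin.all? λ u → Fin.all? λ v → colour₄ u v Fin.≟ colour₄ v u)
  ; exact      = from-yes (Fin.all? λ a → Fin.any? λ u → Fin.any? λ v → (u ≢? v) ×-dec (colour₄ u v Fin.≟ a))
  }
  where
  colour₄ : Fin 4 → Fin 4 → Fin 6
  colour₄ u v = lookup (lookup
    ( (# 0 ∷ # 0 ∷ # 1 ∷ # 2 ∷ [])
    ∷ (# 0 ∷ # 0 ∷ # 3 ∷ # 4 ∷ [])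
    ∷ (# 1 ∷ # 3 ∷ # 0 ∷ # 5 ∷ [])
    ∷ (# 2 ∷ # 4 ∷ # 5 ∷ # 0 ∷ []) ∷ []) u) v

rainbowK₄-avoiding : Avoiding rainbowK₄
rainbowK₄-avoiding = (λ f _ → too-many f) , (λ f _ → too-many f)
  where
  too-many : ∀ {H : Graph 5} → Copy H (K 4) → ⊥
  too-many f = ℕ.1+n≰n (Fin.injective⇒≤ (injective f))

-- The value for k ≥ 7

[1+n]C2 : ∀ n → suc n C 2 ≡ n + n C 2
[1+n]C2 n = trans (sym (nCk+nC[k+1]≡[n+1]C[k+1] n 1)) (cong (_+ n C 2) (nC1≡n n))

-- With N = n + 1 the right side is (2N - 1)², so comparing `k` with `N C 2` amounts to comparing
-- `1 + 8 * k` with a perfect square.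
1+8*[1+n]C2 : ∀ n → 1 + 8 * (suc n C 2) ≡ (1 + 2 * n) * (1 + 2 * n)
1+8*[1+n]C2 zero    = refl
1+8*[1+n]C2 (suc n) = begin
  1 + 8 * (suc (suc n) C 2)             ≡⟨ cong (λ t → 1 + 8 * t) ([1+n]C2 (suc n)) ⟩
  1 + 8 * (suc n + suc n C 2)           ≡⟨ expand (suc n) (suc n C 2) ⟩
  8 * suc n + (1 + 8 * (suc n C 2))     ≡⟨ cong (λ t → 8 * suc n + t) (1+8*[1+n]C2 n) ⟩
  8 * suc n + (1 + 2 * n) * (1 + 2 * n) ≡⟨ square n ⟩
  (1 + 2 * suc n) * (1 + 2 * suc n)     ∎
  where
  open ≡-Reasoning
  expand : ∀ a b → 1 + 8 * (a + b) ≡ 8 * a + (1 + 8 * b)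
  expand = solve-∀
  square : ∀ n → 8 * suc n + (1 + 2 * n) * (1 + 2 * n) ≡ (1 + 2 * suc n) * (1 + 2 * suc n)
  square = solve-∀

least : ∀ {Q : ℕ → Set} → Decidable Q → ∀ m → Q m → ∃[ N ] IsLeast _≤_ Q N
least Q? m qm with Q? 0
... | yes q0 = 0 , q0 , λ _ _ → z≤n
least Q? zero    qm | no ¬q0 = contradiction qm ¬q0
least Q? (suc m) qm | no ¬q0 with N , qN , below ← least (λ i → Q? (suc i)) m qm =
  suc N , qN , λ { zero q0 → contradiction q0 ¬q0 ; (suc y) qy → s≤s (below y qy) }

double-minus-one : ∀ y → + 2 ℤ.* + suc y ℤ.- 1ℤ ≡ + (1 + 2 * y)
double-minus-one y = cong +_ (ℕ.+-suc y (y + 0))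

module _ (k : ℕ) where

  private
    Bound : UpperBounds
    Bound = (1+ (√ (1 + 8 * k))) /2

  bound⁺ : ∀ y → k ≤ suc y C 2 → Bound (+ suc y)
  bound⁺ y k≤ = subst (√ (1 + 8 * k)) (sym (double-minus-one y))
    (ℤ.+≤+ z≤n , subst (+ (1 + 8 * k) ℤ.≤_) (ℤ.pos-* (1 + 2 * y) (1 + 2 * y))
      (ℤ.+≤+ (subst (1 + 8 * k ≤_) (1+8*[1+n]C2 y) (s≤s (ℕ.*-monoʳ-≤ 8 k≤)))))

  bound⁻ : ∀ y → Bound (+ suc y) → k ≤ suc y C 2
  bound⁻ y b with _ , b′ ← subst (√ (1 + 8 * k)) (double-minus-one y) b = ℕ.*-cancelˡ-≤ 8 (ℕ.≤-pred
    (subst (1 + 8 * k ≤_) (sym (1+8*[1+n]C2 y))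
      (ℤ.drop‿+≤+ (subst (+ (1 + 8 * k) ℤ.≤_) (sym (ℤ.pos-* (1 + 2 * y) (1 + 2 * y))) b′))))

  ceiling : ∀ {N} → 1 ≤ N → IsLeast _≤_ (λ y → k ≤ y C 2) N → ⌈ Bound ⌉≐ N
  ceiling {suc N} _ (k≤ , below) = bound⁺ N k≤ , λ where
    -- For z ≤ 0 the number 2z - 1 is negative and fails the sign condition in `√_`.
    (+ zero)  (() , _)
    (+ suc y) b → ℤ.+≤+ (below (suc y) (bound⁻ y b))
    -[1+ y ]  (() , _)

-- `4 C 2` is 6, just short of 7; five vertices are what `upper-bound` asks for.
5≤least : ∀ N → 7 ≤ N C 2 → 5 ≤ N
5≤least N 7≤ with 5 ≤? N
... | yes p = p
... | no  p = contradiction 7≤ (small N (ℕ.≰⇒> p))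
  where
  small : ∀ N → N < 5 → ¬ 7 ≤ N C 2
  small 0 _ = λ ()
  small 1 _ = λ ()
  small 2 _ = ℕ.<⇒≱ (from-yes (2 ≤? 7))
  small 3 _ = ℕ.<⇒≱ (from-yes (4 ≤? 7))
  small 4 _ = ℕ.<⇒≱ (from-yes (7 ≤? 7))
  small (suc (suc (suc (suc (suc _))))) (s≤s (s≤s (s≤s (s≤s (s≤s ())))))

-- The Gallai-Ramsey numbers

upper-bound : ∀ N → 4 ≤ k → 5 ≤ N → 6 ≤ N ⊎ 6 ≤ k → k ≤ N C 2 → GRBound k (P 5) (S 5 1) N
upper-bound N 4≤k 5≤N large k≤NC2 = k≤NC2 , λ n n≥N col →
  Sum.map (rainbowPath⇒copy col) (monoStar⇒copy col)
    (unavoidable col 4≤k (ℕ.≤-trans 5≤N n≥N) (Sum.map₁ (λ 6≤N → ℕ.≤-trans 6≤N n≥N) large))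

gr₃ : gr 3 [ P 5 ∶ S 5 1 ]≐ 21
gr₃ = (from-yes (3 ≤? 21 C 2) , λ n 21≤n col → inj₂ (monoStar⇒copy col (monoStar₃ col 21≤n))) ,
      lower-bound blowUp blowUp-avoiding

gr₄ : gr 4 [ P 5 ∶ S 5 1 ]≐ 6
gr₄ = upper-bound 6 ℕ.≤-refl (from-yes (5 ≤? 6)) (inj₁ ℕ.≤-refl) (from-yes (4 ≤? 6 C 2)) ,
      lower-bound (proj₁ coned₄) (proj₂ coned₄)

gr₅ : gr 5 [ P 5 ∶ S 5 1 ]≐ 6
gr₅ = upper-bound 6 (from-yes (4 ≤? 5)) (from-yes (5 ≤? 6)) (inj₁ ℕ.≤-refl) (from-yes (5 ≤? 6 C 2)) ,
      lower-bound (proj₁ coned₅) (proj₂ coned₅)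

-- K₄ has exactly six edges, so counting edges does not exclude 4; the rainbow colouring of K₄ does.
gr₆ : gr 6 [ P 5 ∶ S 5 1 ]≐ 5
gr₆ = upper-bound 5 (from-yes (4 ≤? 6)) ℕ.≤-refl (inj₂ ℕ.≤-refl) (from-yes (6 ≤? 5 C 2)) ,
      lower-bound rainbowK₄ rainbowK₄-avoiding

theorem3p7 : ∀ (k : ℕ) → k ≥ 3 →
    (k ≡ 3 → gr k [ P 5 ∶ S 5 1 ]≐ 21) ×
    (k ≡ 4 ⊎ k ≡ 5 → gr k [ P 5 ∶ S 5 1 ]≐ 6) ×
    (k ≡ 6 → gr k [ P 5 ∶ S 5 1 ]≐ 5) ×
    (k ≥ 7 → ∃[ N ] (⌈ (1+ (√ (1 + 8 * k))) /2 ⌉≐ N) × (gr k [ P 5 ∶ S 5 1 ]≐ N))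
theorem3p7 k _ =
  (λ { refl → gr₃ }) , (λ { (inj₁ refl) → gr₄ ; (inj₂ refl) → gr₅ }) , (λ { refl → gr₆ }) , λ 7≤k →
  -- `suc k` bounds the search for the least `N`, since it has `k + k C 2` pairs.
  let N , k≤NC2 , below = least (λ y → k ≤? y C 2) (suc k)
        (subst (k ≤_) (sym ([1+n]C2 k)) (ℕ.m≤m+n k (k C 2)))
      5≤N = 5≤least N (ℕ.≤-trans 7≤k k≤NC2)
  in N , ceiling k (ℕ.≤-trans (s≤s z≤n) 5≤N) (k≤NC2 , below) ,
     upper-bound N (ℕ.≤-trans (ℕ.m≤m+n 4 3) 7≤k) 5≤N (inj₂ (ℕ.≤-trans (ℕ.m≤m+n 6 1) 7≤k)) k≤NC2 ,
     -- The lower bound is the edge count: below `N` there are fewer than `k` edges.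
     λ y (k≤yC2 , _) → below y k≤yC2
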